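{- Let $v=12t$ where $t\ge 4$. Then there exists a $(v,3,2)$-BIBD $(X,\mathcal{A})$ that has a strong nesting $\phi:\mathcal{A}\to Y$, $X\subseteq Y$, with $|Y|=w=18t$, and this is optimal: no strong nesting of a $(v,3,2)$-BIBD uses fewer points.
   Context: A $(v,k,\lambda)$-BIBD is a pair $(X,\mathcal{A})$ where $X$ is a set of $v$ points and $\mathcal{A}$ is a multiset of $k$-subsets of $X$ (blocks) such that every pair of distinct points lies in exactly $\lambda$ blocks. Given a $(v,k,\lambda)$-BIBD $(X,\mathcal{A})$ and a set $Y\supseteq X$ with $|Y|=w$, a map $\phi:\mathcal{A}\to Y$ is a strong nesting if (1) $\phi(A)\notin A$ for every block $A\in\mathcal{A}$, and (2) the multiset of pairs $\{\{x,\phi(A)\}: A\in\mathcal{A},\ x\in A\}$ (one pair for each block $A$, counted with multiplicity in $\mathcal{A}$, and each $x\in A$) consists of distinct pairs. A strong nesting is optimal if $w=|Y|$ is as small as possible. -}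

module Defs where

open import Data.Nat using (ℕ; _≤_)
open import Data.Fin using (Fin)
open import Data.Fin.Subset using (Subset; _∈_; ∣_∣; ⁅_⁆; _∪_)
open import Data.Fin.Subset.Properties using (_∈?_)
open import Data.Product using (_×_)
open import Data.Vec using (Vec; lookup; count)
open import Function.Bundles using (_↣_; Injection)
open import Relation.Binary.PropositionalEquality using (_≡_; _≢_)
open import Relation.Nullary.Decidable using (_×-dec_)

-- The point set is Fin v.  The multiset of blocks is a vector of subsets: its
-- order carries no meaning, and a repeated block occupies several positions.
record BIBD (v k μ : ℕ) : Set where
  field
    numBlocks : ℕ
    blocks    : Vec (Subset v) numBlocks

  block : Fin numBlocks → Subset v
  block i = lookup blocks i

  field
    blockSize : ∀ i → ∣ block i ∣ ≡ k
    balanced  : ∀ (x y : Fin v) → x ≢ y →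
                count (λ A → (x ∈? A) ×-dec (y ∈? A)) blocks ≡ μ

-- Subsets are Boolean vectors, so _≡_ on them is extensional and
-- pair a b ≡ pair b a.
pair : ∀ {n} → Fin n → Fin n → Subset n
pair a b = ⁅ a ⁆ ∪ ⁅ b ⁆

-- Y is Fin w, and X ⊆ Y is rendered by an injection of Fin v into Fin w.
-- φ acts on block positions, so equal blocks may have different images.
record StrongNesting {v k μ : ℕ} (𝒟 : BIBD v k μ) (w : ℕ) : Set where
  open BIBD 𝒟
  field
    inclusion : Fin v ↣ Fin w
    φ         : Fin numBlocks → Fin w

  ι : Fin v → Fin w
  ι = Injection.to inclusion

  field
    avoids   : ∀ i x → x ∈ block i → φ i ≢ ι x
    distinct : ∀ i j x y → x ∈ block i → y ∈ block j →
               pair (ι x) (φ i) ≡ pair (ι y) (φ j) → i ≡ j × x ≡ y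

-- The minimum ranges over all designs with the same parameters, not only 𝒟.
Optimal : ∀ {v k μ w} {𝒟 : BIBD v k μ} → StrongNesting 𝒟 w → Set
Optimal {v} {k} {μ} {w} _ =
  ∀ (𝒟′ : BIBD v k μ) (w′ : ℕ) → StrongNesting 𝒟′ w′ → w ≤ w′

{-# OPTIONS --safe #-}
-- Lower bound.  A (v,3,2)-design has v (v - 1) / 3 blocks, so that a strong nesting uses v (v - 1)
-- pairs.  At most v (v - 1) / 2 of them lie inside X and at most v (w - v) leave X, hence
-- 3 v - 1 ≤ 2 w, which for v = 12 t means w ≥ 18 t.
--
-- Existence.  A frame of type gᵐ has m groups of g points and g / 2 extra points each; every pair
-- of points in different groups lies in exactly two blocks, and no block together with its nest
-- contains two points of a group.  Multiplying all points by n with an orthogonal array of strength 2 and four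
-- columns gives a frame of type (g n)ᵐ, and if g n = 6 u a strongly nested design on 6 u points
-- with 3 u extra points can be put on each group, giving one on 6 m u points.  Frames of types 6^q
-- and 12^q for q = 9 and for q coprime to 6 come from blocks {s + c₁ x, s + c₂ x, s + c₃ x} over a
-- ring of order q, with x in a half system, coefficients cᵢ in {±1, ±β}, and nest s.  With the
-- frames of types 4⁴ and 6⁴ these lead from a design on 12 t points to designs on 12 q t and 48 t
-- points, which reduces the theorem to t = 1, 2, 3, 6, and t = 6 to a design on 18 points.
module Submission where

open import Algebra.Bundles using (CommutativeRing)
open import Algebra.Structures using (IsCommutativeRing)
import Algebra.Properties.Group as GroupProperties
import Algebra.Properties.Ring as RingProperties
open import Data.Bool as Bool using (Bool; if_then_else_)
open import Data.Empty using (⊥; ⊥-elim)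
open import Data.Fin as F using (Fin; zero; suc; punchIn; punchOut; toℕ; #_)
import Data.Fin.Properties as F
open import Data.Fin.Subset using (Subset; _∈_; ∣_∣; ⁅_⁆; _∪_; inside)
open import Data.Fin.Subset.Properties using (_∈?_; x∈⁅x⁆; x∈⁅y⁆⇒x≡y; x∈p∪q⁻; x∈p∪q⁺; ∪-comm)
open import Data.List as List using (List; []; _∷_)
open import Data.List.Membership.Propositional using () renaming (_∈_ to _∈ˡ_)
open import Data.List.Membership.Propositional.Properties
  using (∈-filter⁺; ∈-filter⁻; ∈-tabulate⁺; ∈-tabulate⁻; ∈-allFin; ∈-cartesianProduct⁺; ∈-cartesianProduct⁻)
open import Data.List.Relation.Unary.All as All using (All)
open import Data.List.Relation.Unary.AllPairs using ([]; _∷_)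
open import Data.List.Relation.Unary.Any using (here; there)
open import Data.List.Relation.Unary.Unique.Propositional using (Unique)
import Data.List.Relation.Unary.Unique.Propositional.Properties as Unique
open import Data.Nat using (ℕ; zero; suc; _+_; _*_; _∸_; _≤_; _<_; _<ᵇ_; z≤n; s≤s)
open import Data.Nat.DivMod as DivMod using (_/_; _%_; _mod_)
open import Data.Nat.Induction using (<-wellFounded)
import Data.Nat.Properties as ℕ
open import Data.Nat.Tactic.RingSolver using (solve-∀)
open import Data.Product using (Σ; ∃; _×_; _,_; proj₁; proj₂; map₂; uncurry)
open import Data.Product.Function.NonDependent.Propositional using (_×-↔_)
import Data.Product.Properties as Prod
open import Data.Sum as Sum⊎ using (_⊎_; inj₁; inj₂; [_,_]′)
open import Data.Sum.Function.Propositional using (_⊎-↔_)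
import Data.Sum.Properties as Sum
open import Data.Vec using (Vec; []; _∷_; lookup; count; tabulate)
open import Data.Vec.Properties using ([]=⇒lookup; lookup⇒[]=; lookup∘tabulate)
open import Function using (_∘_; id)
open import Function.Bundles using (_↔_; Injection; Inverse; mk↣)
open import Function.Construct.Composition using (_↔-∘_)
open import Function.Construct.Identity using (↔-id)
open import Function.Construct.Symmetry using (↔-sym)
open import Function.Definitions using (Injective)
open import Induction.WellFounded using (Acc; acc)
open import Level using (0ℓ)
open import Relation.Binary.Definitions using (DecidableEquality)
open import Relation.Binary.PropositionalEquality
open import Relation.Nullary using (¬_; Dec; yes; no; contradiction)
open import Relation.Nullary.Decidable using (_×-dec_; _⊎-dec_; _→-dec_; ¬?; map′; from-yes)
open import Relation.Unary using (Decidable)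
open import Defs

-- A frame of type gᵐ leaves none: its blocks use m (m - 1) g² pairs, which is the number of all
-- pairs of points in different groups together with all pairs of a point and an extra point of
-- another group. This is why a group has g / 2 extra points.
--
-- Two obstacles shape the recursion. Weighting needs arrays with four columns, three for the
-- corners of a block and one for its nest; none exists of order 2, and the products formed here
-- miss every order in which 2 has odd exponent. So each group size 12 t is reached by two
-- weightings, as 12 · t or 6 · 2 t, and as 4 · 3 t or 6 · 2 t. Secondly, the ring construction
-- needs β - 1, β and β + 1 to be units, and modulo 3 one of them vanishes. In the field of nine
-- elements β = i works, so factors 3 are removed in pairs and a single one is left to the base
-- cases t = 3 and t = 6.

module _ {A : Set} {P : A → Set} (P? : Decidable P) where

  index : ∀ {n} (xs : Vec A n) → Fin (count P? xs) → Fin n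
  index (x ∷ xs) k with P? x
  index (x ∷ xs) zero    | yes _ = zero
  index (x ∷ xs) (suc k) | yes _ = suc (index xs k)
  index (x ∷ xs) k       | no  _ = suc (index xs k)

  index-holds : ∀ {n} (xs : Vec A n) k → P (lookup xs (index xs k))
  index-holds (x ∷ xs) k with P? x
  index-holds (x ∷ xs) zero    | yes p = p
  index-holds (x ∷ xs) (suc k) | yes _ = index-holds xs k
  index-holds (x ∷ xs) k       | no  _ = index-holds xs k

  index-injective : ∀ {n} (xs : Vec A n) {k l} → index xs k ≡ index xs l → k ≡ l
  index-injective (x ∷ xs) {k} {l} eq with P? x
  index-injective (x ∷ xs) {zero}  {zero}  eq | yes _ = refl
  index-injective (x ∷ xs) {suc k} {suc l} eq | yes _ = cong suc (index-injective xs (F.suc-injective eq))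
  index-injective (x ∷ xs) {k}     {l}     eq | no  _ = index-injective xs (F.suc-injective eq)

  rank : ∀ {n} (xs : Vec A n) i → P (lookup xs i) → Fin (count P? xs)
  rank (x ∷ xs) i p with P? x
  rank (x ∷ xs) zero    p | yes _ = zero
  rank (x ∷ xs) (suc i) p | yes _ = suc (rank xs i p)
  rank (x ∷ xs) zero    p | no ¬p = contradiction p ¬p
  rank (x ∷ xs) (suc i) p | no  _ = rank xs i p

  index-rank : ∀ {n} (xs : Vec A n) i p → index xs (rank xs i p) ≡ i
  index-rank (x ∷ xs) i p with P? x
  index-rank (x ∷ xs) zero    p | yes _ = refl
  index-rank (x ∷ xs) (suc i) p | yes _ = cong suc (index-rank xs i p)
  index-rank (x ∷ xs) zero    p | no ¬p = contradiction p ¬p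
  index-rank (x ∷ xs) (suc i) p | no  _ = cong suc (index-rank xs i p)

  -- Both `∣_∣` and the balance condition are `count`s over a vector, so a bijective enumeration of
  -- the positions where `P` holds evaluates either. Each inequality comes from an injection:
  -- `index` lists these positions in order, and `rank` finds a position in the list.
  count-enumerated : ∀ {n k} (xs : Vec A n) (f : Fin k → Fin n) → Injective _≡_ _≡_ f →
                     (∀ j → P (lookup xs (f j))) →
                     (∀ i → P (lookup xs i) → ∃ λ j → f j ≡ i) → count P? xs ≡ k
  count-enumerated xs f f-inj sound complete = ℕ.≤-antisym
    (F.injective⇒≤ {f = λ k → proj₁ (complete _ (index-holds xs k))} λ {k} {l} eq →
      index-injective xs (trans (sym (proj₂ (complete _ (index-holds xs k))))
        (trans (cong f eq) (proj₂ (complete _ (index-holds xs l))))))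
    (F.injective⇒≤ {f = λ j → rank xs (f j) (sound j)} λ {j} {l} eq →
      f-inj (trans (sym (index-rank xs _ (sound j)))
        (trans (cong (index xs) eq) (index-rank xs _ (sound l)))))

↣⇒≤ : ∀ {m n} {A B : Set} → Fin m ↔ A → Fin n ↔ B → (f : A → B) → Injective _≡_ _≡_ f → m ≤ n
↣⇒≤ α β f f-inj = F.injective⇒≤ {f = from β ∘ f ∘ to α} λ eq →
  Inv.injective α (f-inj (Inv.injective (↔-sym β) eq))
  where
  open Inverse
  module Inv {X Y : Set} (γ : X ↔ Y) where
    injective : ∀ {x y} → to γ x ≡ to γ y → x ≡ y
    injective {x} {y} eq = trans (sym (strictlyInverseʳ γ x)) (trans (cong (from γ) eq) (strictlyInverseʳ γ y))

-- The lower bound, by injections between finite sets.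

module LowerBound {v : ℕ} (𝒟 : BIBD (suc v) 3 2) where
  open BIBD 𝒟

  at : Fin numBlocks → Fin 3 → Fin (suc v)
  at i a = index (Bool._≟ inside) (block i) (F.cast (sym (blockSize i)) a)

  at-∈ : ∀ i a → at i a ∈ block i
  at-∈ i a = lookup⇒[]= _ _ (index-holds (Bool._≟ inside) (block i) _)

  at-injective : ∀ i {a b} → at i a ≡ at i b → a ≡ b
  at-injective i {a} {b} eq = F.toℕ-injective (trans (sym (F.toℕ-cast _ a))
    (trans (cong toℕ (index-injective (Bool._≟ inside) (block i) eq)) (F.toℕ-cast _ b)))

  pos : ∀ i x → x ∈ block i → Fin 3
  pos i x p = F.cast (blockSize i) (rank (Bool._≟ inside) (block i) x ([]=⇒lookup p))

  at-pos : ∀ i x p → at i (pos i x p) ≡ x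
  at-pos i x p = trans (cong (index (Bool._≟ inside) (block i)) (F.toℕ-injective
    (trans (F.toℕ-cast _ (pos i x p)) (F.toℕ-cast _ r)))) (index-rank (Bool._≟ inside) (block i) x _)
    where r = rank (Bool._≟ inside) (block i) x ([]=⇒lookup p)

  -- An ordered pair of distinct points and the choice of one of its two blocks give a block with
  -- two different positions in it. `punchIn` and `punchOut` encode the second point and the second
  -- position relative to the first, so that both sides are plain products.
  pairs≤flags : (suc v * v) * 2 ≤ (numBlocks * 3) * 2
  pairs≤flags = ↣⇒≤ ((F.*↔× ×-↔ ↔-id _) ↔-∘ F.*↔×) ((F.*↔× ×-↔ ↔-id _) ↔-∘ F.*↔×) flag flag-injective
    where
    module _ (x : Fin (suc v)) (y′ : Fin v) (ε : Fin 2) where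
      y : Fin (suc v)
      y = punchIn x y′

      x≢y : x ≢ y
      x≢y = F.punchInᵢ≢i x y′ ∘ sym

      k : Fin (count (λ A → (x ∈? A) ×-dec (y ∈? A)) blocks)
      k = F.cast (sym (balanced x y x≢y)) ε

      i : Fin numBlocks
      i = index _ blocks k

      both : x ∈ block i × y ∈ block i
      both = index-holds _ blocks k

      a b : Fin 3
      a = pos i x (proj₁ both)
      b = pos i y (proj₂ both)

      a≢b : a ≢ b
      a≢b eq = x≢y (trans (sym (at-pos i x (proj₁ both))) (trans (cong (at i) eq) (at-pos i y (proj₂ both))))

    flag : (Fin (suc v) × Fin v) × Fin 2 → (Fin numBlocks × Fin 3) × Fin 2
    flag ((x , y′) , ε) = (i x y′ ε , a x y′ ε) , punchOut (a≢b x y′ ε)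

    recover : ∀ x y′ ε x₁ y₁′ ε₁ → i x y′ ε ≡ i x₁ y₁′ ε₁ → a x y′ ε ≡ a x₁ y₁′ ε₁ →
              b x y′ ε ≡ b x₁ y₁′ ε₁ → ((x , y′) , ε) ≡ ((x₁ , y₁′) , ε₁)
    recover x y′ ε x₁ y₁′ ε₁ eᵢ eₐ e_b
      with trans (sym (at-pos _ x (proj₁ (both x y′ ε)))) (trans (cong₂ at eᵢ eₐ) (at-pos _ x₁ (proj₁ (both x₁ y₁′ ε₁))))
    ... | refl
      with F.punchIn-injective x y′ y₁′
             (trans (sym (at-pos _ _ (proj₂ (both x y′ ε)))) (trans (cong₂ at eᵢ e_b) (at-pos _ _ (proj₂ (both x y₁′ ε₁)))))
    ... | refl = cong ((x , y′) ,_) (F.toℕ-injective (trans (sym (F.toℕ-cast _ ε))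
                   (trans (cong toℕ (index-injective (λ A → (x ∈? A) ×-dec (y x y′ ε ∈? A)) blocks eᵢ)) (F.toℕ-cast _ ε₁))))

    flag-injective : Injective _≡_ _≡_ flag
    flag-injective {(x , y′) , ε} {(x₁ , y₁′) , ε₁} eq = recover x y′ ε x₁ y₁′ ε₁
      (cong (proj₁ ∘ proj₁) eq) (cong (proj₂ ∘ proj₁) eq)
      (trans (sym (F.punchIn-punchOut (a≢b x y′ ε)))
        (trans (cong₂ punchIn (cong (proj₂ ∘ proj₁) eq) (cong proj₂ eq)) (F.punchIn-punchOut (a≢b x₁ y₁′ ε₁))))

  module _ {w : ℕ} (N : StrongNesting 𝒟 w) where
    open StrongNesting N
    private X = Fin (suc v)
            Y = Fin w
            S = ((Fin numBlocks × Fin 3) × Fin 2) ⊎ ((X × X) ⊎ X)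

    ι-injective : ∀ {x y} → ι x ≡ ι y → x ≡ y
    ι-injective = Injection.injective inclusion

    hit? : ∀ z → Dec (∃ λ y → ι y ≡ z)
    hit? z = F.any? λ y → ι y F.≟ z

    swapped : X → (z : Y) → Dec (∃ λ y → ι y ≡ z) → (X × Y) ⊎ (X × Y)
    swapped x z (yes (y , _)) = inj₁ (y , ι x)
    swapped x z (no _)        = inj₂ (x , z)

    -- Every used pair {x , φ A} inside X occupies both orientations in the first copy of X × Y,
    -- a pair leaving X occupies one cell of each copy.
    cell : S → (X × Y) ⊎ (X × Y)
    cell (inj₁ ((i , a) , zero))  = inj₁ (at i a , φ i)
    cell (inj₁ ((i , a) , suc _)) = swapped (at i a) (φ i) (hit? (φ i))
    cell (inj₂ (inj₁ (x , y)))    = inj₂ (x , ι y)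
    cell (inj₂ (inj₂ x))          = inj₁ (x , ι x)

    same : ∀ {i j a b} → pair (ι (at i a)) (φ i) ≡ pair (ι (at j b)) (φ j) → (i , a) ≡ (j , b)
    same {i} {j} {a} {b} eq with distinct i j _ _ (at-∈ i a) (at-∈ j b) eq
    ... | refl , eq′ = cong (i ,_) (at-injective i eq′)

    -- The two flags carry the same unordered pair in opposite orientations, so `distinct`
    -- identifies them, and the block would then contain its own nest.
    crossed : ∀ {i j a b y} → at i a ≡ y → ι y ≡ φ j → φ i ≡ ι (at j b) → ⊥
    crossed {i} {j} {a} {b} refl eⱼ eᵢ with same {i} {j} {a} {b}
      (trans (cong₂ pair eⱼ eᵢ) (∪-comm _ _))
    ... | refl = avoids i _ (at-∈ i a) eᵢ

    cell-injective : Injective _≡_ _≡_ cell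
    cell-injective {inj₁ ((i , a) , zero)} {inj₁ ((j , b) , zero)} eq =
      cong (λ f → inj₁ (f , zero)) (same (cong₂ (λ x → pair (ι x)) (cong proj₁ e) (cong proj₂ e)))
      where e = Sum.inj₁-injective eq
    cell-injective {inj₁ ((i , a) , zero)} {inj₁ ((j , b) , suc zero)} eq with hit? (φ j)
    ... | yes (y , ey) = ⊥-elim (crossed {i} {j} {a} {b} (cong proj₁ e) ey (cong proj₂ e))
      where e = Sum.inj₁-injective eq
    cell-injective {inj₁ ((i , a) , suc zero)} {inj₁ ((j , b) , zero)} eq with hit? (φ i)
    ... | yes (y , ey) = ⊥-elim (crossed {j} {i} {b} {a} (sym (cong proj₁ e)) ey (sym (cong proj₂ e)))
      where e = Sum.inj₁-injective eq
    cell-injective {inj₁ ((i , a) , suc zero)} {inj₁ ((j , b) , suc zero)} eq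
      with hit? (φ i) | hit? (φ j) | eq
    ... | yes (y , ey) | yes (z , ez) | e = cong (λ f → inj₁ (f , suc zero))
      (same (cong₂ pair (cong proj₂ e′) (trans (sym ey) (trans (cong ι (cong proj₁ e′)) ez))))
      where e′ = Sum.inj₁-injective e
    ... | no _ | no _ | e = cong (λ f → inj₁ (f , suc zero)) (same (cong₂ (λ x → pair (ι x)) (cong proj₁ e′) (cong proj₂ e′)))
      where e′ = Sum.inj₂-injective e
    cell-injective {inj₁ ((i , a) , zero)} {inj₂ (inj₂ y)} eq =
      ⊥-elim (avoids i _ (at-∈ i a) (trans (cong proj₂ e) (sym (cong ι (cong proj₁ e)))))
      where e = Sum.inj₁-injective eq
    cell-injective {inj₂ (inj₂ y)} {inj₁ ((i , a) , zero)} eq =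
      ⊥-elim (avoids i _ (at-∈ i a) (trans (sym (cong proj₂ e)) (cong ι (cong proj₁ e))))
      where e = Sum.inj₁-injective eq
    cell-injective {inj₁ ((i , a) , suc zero)} {inj₂ (inj₁ _)} eq with hit? (φ i) | eq
    ... | no ¬h | e = ⊥-elim (¬h (_ , sym (cong proj₂ (Sum.inj₂-injective e))))
    cell-injective {inj₂ (inj₁ _)} {inj₁ ((i , a) , suc zero)} eq with hit? (φ i) | eq
    ... | no ¬h | e = ⊥-elim (¬h (_ , cong proj₂ (Sum.inj₂-injective e)))
    cell-injective {inj₁ ((i , a) , suc zero)} {inj₂ (inj₂ y)} eq with hit? (φ i) | eq
    ... | yes (z , ez) | e = ⊥-elim (avoids i _ (at-∈ i a)
      (trans (sym ez) (trans (cong ι (cong proj₁ e′)) (sym (cong proj₂ e′)))))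
      where e′ = Sum.inj₁-injective e
    cell-injective {inj₂ (inj₂ y)} {inj₁ ((i , a) , suc zero)} eq with hit? (φ i) | eq
    ... | yes (z , ez) | e = ⊥-elim (avoids i _ (at-∈ i a)
      (trans (sym ez) (trans (cong ι (sym (cong proj₁ e′))) (cong proj₂ e′))))
      where e′ = Sum.inj₁-injective e
    cell-injective {inj₂ (inj₁ (x , y))} {inj₂ (inj₁ (x₁ , y₁))} eq =
      cong (inj₂ ∘ inj₁) (cong₂ _,_ (cong proj₁ e) (ι-injective (cong proj₂ e)))
      where e = Sum.inj₂-injective eq
    cell-injective {inj₂ (inj₂ x)} {inj₂ (inj₂ y)} eq =
      cong (inj₂ ∘ inj₂) (cong proj₁ (Sum.inj₁-injective eq))

    -- The summands `suc v * suc v` and `suc v` count cells that no used pair takes: the second copy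
    -- receives only nests outside X, and `avoids` keeps the diagonal of the first copy free.
    -- Including them makes the estimate sharp.
    flags≤cells : (numBlocks * 3) * 2 + (suc v * suc v + suc v) ≤ suc v * w + suc v * w
    flags≤cells = ↣⇒≤
      (((((F.*↔× ×-↔ ↔-id _) ↔-∘ F.*↔×)) ⊎-↔ ((F.*↔× ⊎-↔ ↔-id _) ↔-∘ F.+↔⊎)) ↔-∘ F.+↔⊎)
      ((F.*↔× ⊎-↔ F.*↔×) ↔-∘ F.+↔⊎) cell cell-injective

    3v≤2w+1 : 3 * suc v ≤ 2 * w + 1
    3v≤2w+1 = ℕ.*-cancelˡ-≤ (suc v) (begin
      suc v * (3 * suc v)                                       ≡⟨ lhs v ⟩
      (suc v * v) * 2 + (suc v * suc v + suc v) + suc v         ≤⟨ ℕ.+-monoˡ-≤ (suc v) (ℕ.+-monoˡ-≤ _ pairs≤flags) ⟩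
      (numBlocks * 3) * 2 + (suc v * suc v + suc v) + suc v     ≤⟨ ℕ.+-monoˡ-≤ (suc v) flags≤cells ⟩
      suc v * w + suc v * w + suc v                             ≡⟨ rhs v w ⟩
      suc v * (2 * w + 1)                                       ∎)
      where
      open ℕ.≤-Reasoning
      lhs : ∀ v → suc v * (3 * suc v) ≡ (suc v * v) * 2 + (suc v * suc v + suc v) + suc v
      lhs = solve-∀
      rhs : ∀ v w → suc v * w + suc v * w + suc v ≡ suc v * (2 * w + 1)
      rhs = solve-∀

-- Nested designs on coloured points.

Twice : {B : Set} → (B → Set) → Set
Twice {B} R = Σ B λ b₁ → Σ B λ b₂ → b₁ ≢ b₂ × R b₁ × R b₂ × (∀ b → R b → b ≡ b₁ ⊎ b ≡ b₂)

infix 4 _∈ᵇ_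
_∈ᵇ_ : {P : Set} → P → (Fin 3 → P) → Set
x ∈ᵇ p = ∃ λ i → p i ≡ x

-- Only differently coloured points are joined.  With every point its own colour this is a
-- strongly nested (v,3,2)-design on the points P with Y = P ⊎ Q; with the groups of a partition
-- as colours it is a frame.
record Nested (P Q : Set) {C : Set} (colour : P ⊎ Q → C) : Set₁ where
  field
    Block   : Set
    size    : ℕ
    enum    : Fin size ↔ Block
    pt      : Block → Fin 3 → P
    nest    : Block → P ⊎ Q
    spread  : ∀ b {i j} → i ≢ j → colour (inj₁ (pt b i)) ≢ colour (inj₁ (pt b j))
    avoid   : ∀ b i → colour (nest b) ≢ colour (inj₁ (pt b i))
    cover   : ∀ x y → colour (inj₁ x) ≢ colour (inj₁ y) → Twice λ b → x ∈ᵇ pt b × y ∈ᵇ pt b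
    -- Two used pairs can coincide in two ways, corner with corner or each corner with the nest of
    -- the other block; `once` and `uncross` treat them separately.
    once    : ∀ {b c i j} → pt b i ≡ pt c j → nest b ≡ nest c → b ≡ c
    uncross : ∀ {b c i j} → inj₁ (pt b i) ≡ nest c → nest b ≡ inj₁ (pt c j) → ⊥

  pt-injective : ∀ b {i j} → pt b i ≡ pt b j → i ≡ j
  pt-injective b {i} {j} eq with i F.≟ j
  ... | yes i≡j = i≡j
  ... | no i≢j  = ⊥-elim (spread b i≢j (cong (colour ∘ inj₁) eq))

StrongDesign : ℕ → ℕ → Set₁
StrongDesign v e = Nested (Fin v) (Fin e) id

Frame : Set → Set → Set → Set₁
Frame G A B = Nested (G × A) (G × B) {G} [ proj₁ , proj₁ ]′

module _ {P Q P′ Q′ : Set} (α : P′ ↔ P) (β : Q′ ↔ Q) where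
  private
    module α = Inverse α
    module β = Inverse β

    f : P ⊎ Q → P′ ⊎ Q′
    f = Sum⊎.map α.from β.from
    g : P′ ⊎ Q′ → P ⊎ Q
    g = Sum⊎.map α.to β.to

    gf : ∀ y → g (f y) ≡ y
    gf (inj₁ x) = cong inj₁ (α.strictlyInverseˡ x)
    gf (inj₂ x) = cong inj₂ (β.strictlyInverseˡ x)

    fg : ∀ y → f (g y) ≡ y
    fg (inj₁ x) = cong inj₁ (α.strictlyInverseʳ x)
    fg (inj₂ x) = cong inj₂ (β.strictlyInverseʳ x)

    f-inj : ∀ {y z} → f y ≡ f z → y ≡ z
    f-inj eq = trans (sym (gf _)) (trans (cong g eq) (gf _))

    from-inj : ∀ {y z} → α.from y ≡ α.from z → y ≡ z
    from-inj eq = trans (sym (α.strictlyInverseˡ _)) (trans (cong α.to eq) (α.strictlyInverseˡ _))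

  relabel : ∀ {C} {colour : P ⊎ Q → C} → Nested P Q colour → Nested P′ Q′ (colour ∘ g)
  relabel {C} {colour} D = record
    { Block = Block ; size = size ; enum = enum
    ; pt = λ b → α.from ∘ pt b
    ; nest = f ∘ nest
    ; spread = λ b i≢j eq → spread b i≢j (trans (sym (c _)) (trans eq (c _)))
    ; avoid = λ b i eq → avoid b i (trans (sym (cong colour (gf (nest b)))) (trans eq (c _)))
    ; cover = λ x y x≢y → let (b , c , b≢c , (p , q) , (r , s) , only) = cover (α.to x) (α.to y) x≢y in
        b , c , b≢c , (⇐ p , ⇐ q) , (⇐ r , ⇐ s) , λ d (t , u) → only d (⇒ t , ⇒ u)
    ; once = λ e₁ e₂ → once (from-inj e₁) (f-inj e₂)
    ; uncross = λ e₁ e₂ → uncross (f-inj e₁) (f-inj e₂)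
    }
    where
    open Nested D
    c : ∀ x → colour (inj₁ (α.to (α.from x))) ≡ colour (inj₁ x)
    c x = cong (colour ∘ inj₁) (α.strictlyInverseˡ x)
    ⇐ : ∀ {b x} → α.to x ∈ᵇ pt b → x ∈ᵇ (α.from ∘ pt b)
    ⇐ (i , eq) = i , trans (cong α.from eq) (α.strictlyInverseʳ _)
    ⇒ : ∀ {b x} → x ∈ᵇ (α.from ∘ pt b) → α.to x ∈ᵇ pt b
    ⇒ (i , eq) = i , trans (sym (α.strictlyInverseˡ _)) (cong α.to eq)

  -- `relabel` produces the colouring `g`, which is injective and hence separates the same points as
  -- `id`.
  relabel-id : Nested P Q id → Nested P′ Q′ id
  relabel-id D = record
    { Block = Block ; size = size ; enum = enum
    ; pt = pt ; nest = nest ; cover = λ x y x≢y → cover x y (x≢y ∘ g-inj)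
    ; spread = λ b i≢j eq → spread b i≢j (cong g eq)
    ; avoid = λ b i eq → avoid b i (cong g eq)
    ; once = once ; uncross = uncross }
    where
    open Nested (relabel D)
    g-inj : ∀ {y z} → g y ≡ g z → y ≡ z
    g-inj eq = trans (sym (fg _)) (trans (cong f eq) (fg _))

-- From a nested design to a block design with a strong nesting.

module _ {v e : ℕ} (D : StrongDesign v e) where
  open Nested D
  private
    module E = Inverse enum

    triple : (Fin 3 → Fin v) → Subset v
    triple p = ⁅ p zero ⁆ ∪ (⁅ p (suc zero) ⁆ ∪ ⁅ p (suc (suc zero)) ⁆)

    ∈triple⁻ : ∀ p {x} → x ∈ triple p → x ∈ᵇ p
    ∈triple⁻ p x∈ with x∈p∪q⁻ _ _ x∈
    ... | inj₁ q = zero , sym (x∈⁅y⁆⇒x≡y _ q)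
    ... | inj₂ q with x∈p∪q⁻ _ _ q
    ...   | inj₁ r = suc zero , sym (x∈⁅y⁆⇒x≡y _ r)
    ...   | inj₂ r = suc (suc zero) , sym (x∈⁅y⁆⇒x≡y _ r)

    ∈triple⁺ : ∀ p i → p i ∈ triple p
    ∈triple⁺ p zero             = x∈p∪q⁺ (inj₁ (x∈⁅x⁆ _))
    ∈triple⁺ p (suc zero)       = x∈p∪q⁺ (inj₂ (x∈p∪q⁺ (inj₁ (x∈⁅x⁆ _))))
    ∈triple⁺ p (suc (suc zero)) = x∈p∪q⁺ {p = ⁅ p zero ⁆} (inj₂ (x∈p∪q⁺ {p = ⁅ p (suc zero) ⁆} (inj₂ (x∈⁅x⁆ _))))

    tri : Fin size → Subset v
    tri = triple ∘ pt ∘ E.to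

    bs : Vec (Subset v) size
    bs = tabulate tri

    lookup-bs : ∀ i → lookup bs i ≡ tri i
    lookup-bs = lookup∘tabulate tri

    E-from : ∀ {i b} → E.to i ≡ b → i ≡ E.from b
    E-from {i} refl = sym (E.strictlyInverseʳ i)

  toBIBD : BIBD v 3 2
  toBIBD = record
    { numBlocks = size
    ; blocks    = bs
    ; blockSize = λ i → trans (cong ∣_∣ (lookup-bs i)) (triple-size i)
    ; balanced  = bal
    }
    where
    triple-size : ∀ i → ∣ tri i ∣ ≡ 3
    triple-size i = count-enumerated (Bool._≟ inside) (tri i) (pt (E.to i)) (pt-injective (E.to i))
      (λ j → []=⇒lookup (∈triple⁺ (pt (E.to i)) j)) (λ x eq → ∈triple⁻ _ (lookup⇒[]= x _ eq))

    bal : ∀ x y → x ≢ y → count (λ A → (x ∈? A) ×-dec (y ∈? A)) bs ≡ 2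
    bal x y x≢y with cover x y (x≢y ∘ Sum.inj₁-injective)
    ... | b , c , b≢c , b-ok , c-ok , only = count-enumerated _ bs f f-inj sound complete
      where
      f : Fin 2 → Fin size
      f zero    = E.from b
      f (suc _) = E.from c

      from≢ : E.from b ≢ E.from c
      from≢ eq = b≢c (trans (sym (E.strictlyInverseˡ b)) (trans (cong E.to eq) (E.strictlyInverseˡ c)))

      f-inj : Injective _≡_ _≡_ f
      f-inj {zero}     {zero}     _  = refl
      f-inj {zero}     {suc zero} eq = ⊥-elim (from≢ eq)
      f-inj {suc zero} {zero}     eq = ⊥-elim (from≢ (sym eq))
      f-inj {suc zero} {suc zero} _  = refl

      member : ∀ {d z} → z ∈ᵇ pt d → z ∈ lookup bs (E.from d)
      member {d} {z} (i , refl) = subst (z ∈_)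
        (sym (trans (lookup-bs (E.from d)) (cong (triple ∘ pt) (E.strictlyInverseˡ d)))) (∈triple⁺ (pt d) i)

      sound : ∀ j → x ∈ lookup bs (f j) × y ∈ lookup bs (f j)
      sound zero    = member (proj₁ b-ok) , member (proj₂ b-ok)
      sound (suc _) = member (proj₁ c-ok) , member (proj₂ c-ok)

      complete : ∀ i → x ∈ lookup bs i × y ∈ lookup bs i → ∃ λ j → f j ≡ i
      complete i (p , q) with only (E.to i) (∈triple⁻ _ (subst (x ∈_) (lookup-bs i) p)
                                            , ∈triple⁻ _ (subst (y ∈_) (lookup-bs i) q))
      ... | inj₁ eq = zero , sym (E-from eq)
      ... | inj₂ eq = suc zero , sym (E-from eq)

  toNesting : StrongNesting toBIBD (v + e)
  toNesting = record
    { inclusion = mk↣ (F.↑ˡ-injective e _ _)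
    ; φ         = φ
    ; avoids    = λ i x x∈ eq → let (j , xj) = mem i x∈ in
        avoid (E.to i) j (trans (join-inj (trans eq (sym refl))) (cong inj₁ (sym xj)))
    ; distinct  = dist
    }
    where
    φ : Fin size → Fin (v + e)
    φ i = F.join v e (nest (E.to i))

    join-inj : ∀ {y z} → F.join v e y ≡ F.join v e z → y ≡ z
    join-inj {y} {z} eq = trans (sym (F.splitAt-join v e y)) (trans (cong (F.splitAt v) eq) (F.splitAt-join v e z))

    mem : ∀ i {x} → x ∈ lookup bs i → x ∈ᵇ pt (E.to i)
    mem i x∈ = ∈triple⁻ _ (subst (_ ∈_) (lookup-bs i) x∈)

    -- The third case is what remains when `a` and `b` fall on the same element; for a corner and
    -- its nest `avoid` excludes it.
    pair-cases : ∀ {n} {a b c d : Fin n} → pair a b ≡ pair c d → (a ≡ c × b ≡ d) ⊎ (a ≡ d × b ≡ c) ⊎ (a ≡ b)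
    pair-cases {a = a} {b} {c} {d} eq
      with x∈p∪q⁻ _ _ (subst (a ∈_) eq (x∈p∪q⁺ (inj₁ (x∈⁅x⁆ a))))
         | x∈p∪q⁻ _ _ (subst (b ∈_) eq (x∈p∪q⁺ {p = ⁅ a ⁆} (inj₂ (x∈⁅x⁆ b))))
    ... | inj₁ p | inj₂ q = inj₁ (x∈⁅y⁆⇒x≡y _ p , x∈⁅y⁆⇒x≡y _ q)
    ... | inj₂ p | inj₁ q = inj₂ (inj₁ (x∈⁅y⁆⇒x≡y _ p , x∈⁅y⁆⇒x≡y _ q))
    ... | inj₁ p | inj₁ q = inj₂ (inj₂ (trans (x∈⁅y⁆⇒x≡y _ p) (sym (x∈⁅y⁆⇒x≡y _ q))))
    ... | inj₂ p | inj₂ q = inj₂ (inj₂ (trans (x∈⁅y⁆⇒x≡y _ p) (sym (x∈⁅y⁆⇒x≡y _ q))))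

    dist : ∀ i j x y → x ∈ lookup bs i → y ∈ lookup bs j →
           pair (x F.↑ˡ e) (φ i) ≡ pair (y F.↑ˡ e) (φ j) → i ≡ j × x ≡ y
    dist i j x y x∈ y∈ eq with mem i x∈ | mem j y∈ | pair-cases eq
    ... | a , refl | b , refl | inj₁ (e₁ , e₂) = i≡j , x≡y
      where
      x≡y = F.↑ˡ-injective e _ _ e₁
      i≡j = trans (E-from (once x≡y (join-inj e₂))) (E.strictlyInverseʳ j)
    ... | a , refl | b , refl | inj₂ (inj₁ (e₁ , e₂)) = ⊥-elim (uncross (join-inj e₁) (join-inj e₂))
    ... | a , refl | b , refl | inj₂ (inj₂ e₁) = ⊥-elim (avoid (E.to i) a (join-inj (sym e₁)))

-- Weighting a frame by an orthogonal array.

record OA (W : Set) : Set where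
  field
    col    : Fin 4 → W × W → W
    solve  : ∀ {i j} → i ≢ j → ∀ u v → Σ (W × W) λ r → col i r ≡ u × col j r ≡ v
    unique : ∀ {i j} → i ≢ j → ∀ {r s} → col i r ≡ col i s → col j r ≡ col j s → r ≡ s

module _ {G A B : Set} {n : ℕ} (F : Frame G A B) (O : OA (Fin n)) where
  open Nested F
  open OA O
  private
    W = Fin n

    attach : (G × A) ⊎ (G × B) → W → (G × A × W) ⊎ (G × B × W)
    attach (inj₁ (g , a)) w = inj₁ (g , a , w)
    attach (inj₂ (g , b)) w = inj₂ (g , b , w)

    attach-injective : ∀ {y z w w′} → attach y w ≡ attach z w′ → y ≡ z × w ≡ w′
    attach-injective {inj₁ _} {inj₁ _} refl = refl , refl
    attach-injective {inj₂ _} {inj₂ _} refl = refl , refl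

    colour : (G × A) ⊎ (G × B) → G
    colour = [ proj₁ , proj₁ ]′

    colour′ : (G × A × W) ⊎ (G × B × W) → G
    colour′ = [ proj₁ , proj₁ ]′

    attach-colour : ∀ y w → colour′ (attach y w) ≡ colour y
    attach-colour (inj₁ _) w = refl
    attach-colour (inj₂ _) w = refl

    ptʷ : Block × (W × W) → Fin 3 → G × A × W
    ptʷ (b , r) i = proj₁ (pt b i) , proj₂ (pt b i) , col (F.inject₁ i) r

    ptʷ≡ : ∀ {b c r s i j} → ptʷ (b , r) i ≡ ptʷ (c , s) j →
           pt b i ≡ pt c j × col (F.inject₁ i) r ≡ col (F.inject₁ j) s
    ptʷ≡ eq = cong (map₂ proj₁) eq , cong (proj₂ ∘ proj₂) eq

    last≢ : ∀ {i : Fin 3} → F.inject₁ i ≢ F.fromℕ 3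
    last≢ = F.fromℕ≢inject₁ ∘ sym

  -- An instance of Wilson's fundamental construction: a block is replaced by one copy for each row
  -- of the array, with three columns placing the corners and the fourth the nest. Two columns
  -- determine the row, which yields `cover` from two corners and `once` from a corner and the nest.
  weight : Frame G (A × Fin n) (B × Fin n)
  weight = record
    { Block   = Block × (W × W)
    ; size    = size * (n * n)
    ; enum    = (enum ×-↔ F.*↔×) ↔-∘ F.*↔×
    ; pt      = ptʷ
    ; nest    = λ (b , r) → attach (nest b) (col (F.fromℕ 3) r)
    ; spread  = λ (b , r) → spread b
    ; avoid   = λ (b , r) i eq → avoid b i (trans (sym (attach-colour (nest b) _)) eq)
    ; cover   = λ (g , x , u) (h , y , v) g≢h → coverʷ g x u h y v g≢h
    ; once    = onceʷ
    ; uncross = λ e₁ e₂ → uncross (proj₁ (attach-injective {inj₁ _} e₁)) (proj₁ (attach-injective {z = inj₁ _} e₂))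
    }
    where
    onceʷ : ∀ {b c i j} → ptʷ b i ≡ ptʷ c j →
            attach (nest (proj₁ b)) (col (F.fromℕ 3) (proj₂ b)) ≡ attach (nest (proj₁ c)) (col (F.fromℕ 3) (proj₂ c)) →
            b ≡ c
    onceʷ {b , r} {c , s} {i} {j} e₁ e₂ with ptʷ≡ {b} {c} {r} {s} {i} {j} e₁ | attach-injective e₂
    ... | p , p′ | q , q′ with once p q
    ... | refl with pt-injective b p
    ... | refl = cong (b ,_) (unique last≢ p′ q′)

    coverʷ : ∀ g x u h y v → g ≢ h → Twice λ b → (g , x , u) ∈ᵇ ptʷ b × (h , y , v) ∈ᵇ ptʷ b
    coverʷ g x u h y v g≢h with cover (g , x) (h , y) g≢h
    ... | b , c , b≢c , m , n , only = (b , proj₁ (row m)) , (c , proj₁ (row n)) , b≢c ∘ cong proj₁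
                                     , proj₂ (row m) , proj₂ (row n) , only′
      where
      distinct-positions : ∀ {d i j} → pt d i ≡ (g , x) → pt d j ≡ (h , y) → F.inject₁ i ≢ F.inject₁ j
      distinct-positions eᵢ eⱼ i≡j with F.inject₁-injective i≡j
      ... | refl = g≢h (cong proj₁ (trans (sym eᵢ) eⱼ))

      row : ∀ {d} → (g , x) ∈ᵇ pt d × (h , y) ∈ᵇ pt d →
            Σ (W × W) λ r → (g , x , u) ∈ᵇ ptʷ (d , r) × (h , y , v) ∈ᵇ ptʷ (d , r)
      row {d} ((i , eᵢ) , (j , eⱼ)) = r , (i , cong₂ (λ (g , x) w → g , x , w) eᵢ p) , (j , cong₂ (λ (g , x) w → g , x , w) eⱼ q)
        where
        sol = solve (distinct-positions {d} eᵢ eⱼ) u v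
        r = proj₁ sol
        p = proj₁ (proj₂ sol)
        q = proj₂ (proj₂ sol)

      only′ : ∀ d → (g , x , u) ∈ᵇ ptʷ d × (h , y , v) ∈ᵇ ptʷ d →
              d ≡ (b , proj₁ (row m)) ⊎ d ≡ (c , proj₁ (row n))
      only′ (d , r) ((i , eᵢ) , (j , eⱼ)) = Sum⊎.map (same m) (same n)
          (only d ((i , cong (map₂ proj₁) eᵢ) , (j , cong (map₂ proj₁) eⱼ)))
        where
        same : ∀ {d′} (k : (g , x) ∈ᵇ pt d′ × (h , y) ∈ᵇ pt d′) → d ≡ d′ → (d , r) ≡ (d′ , proj₁ (row k))
        same k@((i′ , eᵢ′) , (j′ , eⱼ′)) refl
          with pt-injective d (trans (cong (map₂ proj₁) eᵢ) (sym eᵢ′)) | pt-injective d (trans (cong (map₂ proj₁) eⱼ) (sym eⱼ′))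
        ... | refl | refl = cong (d ,_) (unique (distinct-positions {d} eᵢ′ eⱼ′)
                (trans (cong (proj₂ ∘ proj₂) eᵢ) (sym (proj₁ (proj₂ sol))))
                (trans (cong (proj₂ ∘ proj₂) eⱼ) (sym (proj₂ (proj₂ sol)))))
          where sol = solve (distinct-positions {d} eᵢ′ eⱼ′) u v

-- Filling the groups of a frame.

module _ {m : ℕ} {A B : Set} (F : Frame (Fin m) A B) (D : Nested A B id) where
  private
    module F′ = Nested F
    module D = Nested D
    G = Fin m

    tag : G → A ⊎ B → (G × A) ⊎ (G × B)
    tag g = Sum⊎.map (g ,_) (g ,_)

    colour : (G × A) ⊎ (G × B) → G
    colour = [ proj₁ , proj₁ ]′

    tag-colour : ∀ g y → colour (tag g y) ≡ g
    tag-colour g (inj₁ _) = refl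
    tag-colour g (inj₂ _) = refl

    tag-injective : ∀ {g h y z} → tag g y ≡ tag h z → g ≡ h × y ≡ z
    tag-injective {y = inj₁ _} {inj₁ _} refl = refl , refl
    tag-injective {y = inj₂ _} {inj₂ _} refl = refl , refl

    Blockᶠ : Set
    Blockᶠ = F′.Block ⊎ (G × D.Block)

    ptᶠ : Blockᶠ → Fin 3 → G × A
    ptᶠ (inj₁ b)       i = F′.pt b i
    ptᶠ (inj₂ (g , c)) i = g , D.pt c i

    nestᶠ : Blockᶠ → (G × A) ⊎ (G × B)
    nestᶠ (inj₁ b)       = F′.nest b
    nestᶠ (inj₂ (g , c)) = tag g (D.nest c)

  -- For a frame, `spread` and `avoid` speak of groups: its blocks and their used pairs join
  -- different groups, whereas those of a filling design stay within one. Hence the mixed cases of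
  -- `once` and `uncross` contradict `avoid`, and each pair of points is covered by one kind of
  -- block only.
  fill : Nested (Fin m × A) (Fin m × B) id
  fill = record
    { Block   = Blockᶠ
    ; size    = F′.size + m * D.size
    ; enum    = (F′.enum ⊎-↔ ((↔-id _ ×-↔ D.enum) ↔-∘ F.*↔×)) ↔-∘ F.+↔⊎
    ; pt      = ptᶠ
    ; nest    = nestᶠ
    ; spread  = spreadᶠ
    ; avoid   = avoidᶠ
    ; cover   = λ (g , x) (h , y) x≢y → coverᶠ g x h y x≢y
    ; once    = λ {b} {c} → onceᶠ {b} {c}
    ; uncross = λ {b} {c} → uncrossᶠ {b} {c}
    }
    where
    spreadᶠ : ∀ b {i j} → i ≢ j → inj₁ {B = G × B} (ptᶠ b i) ≢ inj₁ (ptᶠ b j)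
    spreadᶠ (inj₁ b)       i≢j eq = F′.spread b i≢j (cong colour eq)
    spreadᶠ (inj₂ (g , c)) i≢j eq = D.spread c i≢j (cong inj₁ (cong proj₂ (Sum.inj₁-injective eq)))

    avoidᶠ : ∀ b i → nestᶠ b ≢ inj₁ (ptᶠ b i)
    avoidᶠ (inj₁ b)       i eq = F′.avoid b i (cong colour eq)
    avoidᶠ (inj₂ (g , c)) i eq = D.avoid c i (proj₂ (tag-injective {y = D.nest c} {inj₁ (D.pt c i)} eq))

    onceᶠ : ∀ {b c i j} → ptᶠ b i ≡ ptᶠ c j → nestᶠ b ≡ nestᶠ c → b ≡ c
    onceᶠ {inj₁ b}       {inj₁ c}       e₁ e₂ = cong inj₁ (F′.once e₁ e₂)
    onceᶠ {inj₁ b}       {inj₂ (h , c)} {i} e₁ e₂ = ⊥-elim (F′.avoid b i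
      (trans (cong colour e₂) (trans (tag-colour h (D.nest c)) (sym (cong proj₁ e₁)))))
    onceᶠ {inj₂ (g , b)} {inj₁ c}       {j = j} e₁ e₂ = ⊥-elim (F′.avoid c j
      (trans (cong colour (sym e₂)) (trans (tag-colour g (D.nest b)) (cong proj₁ e₁))))
    onceᶠ {inj₂ (g , b)} {inj₂ (h , c)} e₁ e₂ with tag-injective {y = D.nest b} {D.nest c} e₂
    ... | refl , q = cong (λ d → inj₂ (g , d)) (D.once (cong proj₂ e₁) q)

    uncrossᶠ : ∀ {b c i j} → inj₁ (ptᶠ b i) ≡ nestᶠ c → nestᶠ b ≡ inj₁ (ptᶠ c j) → ⊥
    uncrossᶠ {inj₁ b}       {inj₁ c}       e₁ e₂ = F′.uncross e₁ e₂
    uncrossᶠ {inj₁ b}       {inj₂ (h , c)} {i} e₁ e₂ = F′.avoid b i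
      (trans (cong colour e₂) (sym (trans (cong colour e₁) (tag-colour h (D.nest c)))))
    uncrossᶠ {inj₂ (g , b)} {inj₁ c}       {j = j} e₁ e₂ = F′.avoid c j
      (trans (sym (cong colour e₁)) (trans (sym (tag-colour g (D.nest b))) (cong colour e₂)))
    uncrossᶠ {inj₂ (g , b)} {inj₂ (h , c)} {i} {j} e₁ e₂
      with tag-injective {g} {h} {inj₁ (D.pt b i)} {D.nest c} e₁
    ... | refl , p = D.uncross p (proj₂ (tag-injective {y = D.nest b} {inj₁ (D.pt c j)} e₂))

    coverᶠ : ∀ g x h y → inj₁ {B = G × B} (g , x) ≢ inj₁ (h , y) → Twice λ b → (g , x) ∈ᵇ ptᶠ b × (h , y) ∈ᵇ ptᶠ b
    coverᶠ g x h y x≢y with g F.≟ h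
    ... | no g≢h with F′.cover (g , x) (h , y) g≢h
    ...   | b , c , b≢c , m , n , only = inj₁ b , inj₁ c , b≢c ∘ Sum.inj₁-injective , m , n , λ
            { (inj₁ d) p → Sum⊎.map (cong inj₁) (cong inj₁) (only d p)
            ; (inj₂ (k , d)) ((i , e₁) , (j , e₂)) →
                ⊥-elim (g≢h (trans (sym (cong proj₁ e₁)) (cong proj₁ e₂))) }
    coverᶠ g x .g y x≢y | yes refl with D.cover x y (λ e → x≢y (cong (tag g) e))
    ...   | b , c , b≢c , (p , q) , (r , s) , only =
            inj₂ (g , b) , inj₂ (g , c) , b≢c ∘ cong proj₂ ∘ Sum.inj₂-injective
            , (⇐ p , ⇐ q) , (⇐ r , ⇐ s) , only′
      where
      ⇐ : ∀ {z d} → z ∈ᵇ D.pt d → (g , z) ∈ᵇ ptᶠ (inj₂ (g , d))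
      ⇐ (i , e) = i , cong (g ,_) e

      only′ : ∀ d → (g , x) ∈ᵇ ptᶠ d × (g , y) ∈ᵇ ptᶠ d → d ≡ inj₂ (g , b) ⊎ d ≡ inj₂ (g , c)
      only′ (inj₂ (k , d)) ((i , refl) , (j , e)) =
        Sum⊎.map (cong (λ d → inj₂ (k , d))) (cong (λ d → inj₂ (k , d))) (only d ((i , refl) , (j , cong proj₂ e)))
      only′ (inj₁ d) ((i , e₁) , (j , e₂)) with i F.≟ j
      ... | yes refl = ⊥-elim (x≢y (cong inj₁ (trans (sym e₁) e₂)))
      ... | no i≢j   = ⊥-elim (F′.spread d i≢j (trans (cong proj₁ e₁) (sym (cong proj₁ e₂))))

U : ℕ → Set₁
U u = StrongDesign (6 * u) (3 * u)

castFin : ∀ {m n} → m ≡ n → Fin m ↔ Fin n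
castFin refl = ↔-id _

-- Weight n turns 2 k points and k extra points per group into 2 k n = 6 u and k n = 3 u, the
-- parameters of `U u`.
expand : ∀ {m k n u} → Frame (Fin m) (Fin (2 * k)) (Fin k) → OA (Fin n) → k * n ≡ 3 * u → U u → U (m * u)
expand {m} {k} {n} {u} F O kn≡3u D = relabel-id
  ((↔-id _ ×-↔ α) ↔-∘ (F.*↔× ↔-∘ castFin (swap 6 m u)))
  ((↔-id _ ×-↔ β) ↔-∘ (F.*↔× ↔-∘ castFin (swap 3 m u)))
  (fill (weight F O) (relabel-id α′ β′ D))
  where
  swap : ∀ a b c → a * (b * c) ≡ b * (a * c)
  swap = solve-∀
  6u≡ : 6 * u ≡ 2 * k * n
  6u≡ = trans (six u) (trans (cong (2 *_) (sym kn≡3u)) (sym (ℕ.*-assoc 2 k n)))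
    where
    six : ∀ u → 6 * u ≡ 2 * (3 * u)
    six = solve-∀
  α : Fin (6 * u) ↔ (Fin (2 * k) × Fin n)
  α = F.*↔× ↔-∘ castFin 6u≡
  α′ = ↔-sym α
  β : Fin (3 * u) ↔ (Fin k × Fin n)
  β = F.*↔× ↔-∘ castFin (sym kn≡3u)
  β′ = ↔-sym β

-- Designs given by a table and verified by evaluation.

module Explicit {P Q C : Set} (_≟P_ : DecidableEquality P) (_≟Q_ : DecidableEquality Q) (_≟C_ : DecidableEquality C)
                (colour : P ⊎ Q → C)
                (points : List P) (∈points : ∀ x → x ∈ˡ points) (extras : List Q) (∈extras : ∀ y → y ∈ˡ extras) where

  Entry : Set
  Entry = P × P × P × (P ⊎ Q)

  corner : Entry → Fin 3 → P
  corner (a , b , c , _) zero             = a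
  corner (a , b , c , _) (suc zero)       = b
  corner (a , b , c , _) (suc (suc zero)) = c

  nestOf : Entry → P ⊎ Q
  nestOf (_ , _ , _ , d) = d

  Has : P → Entry → Set
  Has x (a , b , c , _) = x ≡ a ⊎ x ≡ b ⊎ x ≡ c

  has? : ∀ x t → Dec (Has x t)
  has? x (a , b , c , _) = (x ≟P a) ⊎-dec ((x ≟P b) ⊎-dec (x ≟P c))

  Rainbow : Entry → Set
  Rainbow (a , b , c , d) = 
      (colour (inj₁ a) ≢ colour (inj₁ b) × colour (inj₁ a) ≢ colour (inj₁ c) × colour (inj₁ b) ≢ colour (inj₁ c))
    × (colour d ≢ colour (inj₁ a) × colour d ≢ colour (inj₁ b) × colour d ≢ colour (inj₁ c))

  rainbow? : ∀ t → Dec (Rainbow t)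
  rainbow? (a , b , c , d) = ((inj₁ a ≠ inj₁ b) ×-dec ((inj₁ a ≠ inj₁ c) ×-dec (inj₁ b ≠ inj₁ c)))
    ×-dec ((d ≠ inj₁ a) ×-dec ((d ≠ inj₁ b) ×-dec (d ≠ inj₁ c)))
    where
    _≠_ : ∀ y z → Dec (colour y ≢ colour z)
    y ≠ z = ¬? (colour y ≟C colour z)

  Contains : Entry → P ⊎ Q → Set
  Contains t y = ∃ λ x → y ≡ inj₁ x × Has x t

  contains? : ∀ t y → Dec (Contains t y)
  contains? t (inj₁ x) = map′ (λ h → x , refl , h) (λ { (_ , refl , h) → h }) (has? x t)
  contains? t (inj₂ _) = no λ { (_ , () , _) }

  Meets : Entry → Entry → Set
  Meets (a , b , c , _) u = Has a u ⊎ Has b u ⊎ Has c u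

  meets? : ∀ t u → Dec (Meets t u)
  meets? (a , b , c , _) u = has? a u ⊎-dec (has? b u ⊎-dec has? c u)

  module _ (bs : List Entry) where

    N : ℕ
    N = List.length bs

    entry : Fin N → Entry
    entry = List.lookup bs

    table : List (Fin N × Entry)
    table = List.tabulate λ i → i , entry i

    through : P → List (Fin N × Entry) → List (Fin N × Entry)
    through x = List.filter (has? x ∘ proj₂)

    nestedAt : P ⊎ Q → List (Fin N × Entry) → List (Fin N × Entry)
    nestedAt y = List.filter λ (_ , t) → Sum.≡-dec _≟P_ _≟Q_ (nestOf t) y

    Covered : P → List (Fin N × Entry) → Set
    Covered x row = All (λ y → colour (inj₁ x) ≡ colour (inj₁ y) ⊎ List.length (through y row) ≡ 2) points

    Disjoint : List (Fin N × Entry) → Set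
    Disjoint ts = All (λ (i , t) → All (λ (j , u) → ¬ Meets t u ⊎ i ≡ j) ts) ts

    Uncrossed : List (Fin N × Entry) → List (Fin N × Entry) → Set
    Uncrossed row ts = All (λ (_ , t) → All (λ (_ , u) → ¬ Contains t (nestOf u)) row) ts

    -- Positions accompany the entries because equal entries would be different blocks. Two used
    -- pairs can coincide only if their blocks share the nest, or if one block is nested at a point
    -- `x` of the other; so it suffices to compare within the short lists of entries nested at, or
    -- passing through, a given element.
    Valid : List (Fin N × Entry) → Set
    Valid tab =
        All (λ (i , t) → Rainbow t) tab
      × All (λ x → Covered x (through x tab) × Disjoint (nestedAt (inj₁ x) tab)
                   × Uncrossed (through x tab) (nestedAt (inj₁ x) tab)) points
      × All (λ y → Disjoint (nestedAt (inj₂ y) tab)) extras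

    valid? : ∀ tab → Dec (Valid tab)
    valid? tab =
      All.all? (λ (i , t) → rainbow? t) tab
      ×-dec (All.all? (λ x → point? x (through x tab) (nestedAt (inj₁ x) tab)) points
      ×-dec All.all? (λ y → disjoint? (nestedAt (inj₂ y) tab)) extras)
      where
      disjoint? : ∀ ts → Dec (Disjoint ts)
      disjoint? ts = All.all? (λ (i , t) → All.all? (λ (j , u) → ¬? (meets? t u) ⊎-dec (i F.≟ j)) ts) ts

      point? : ∀ x row ts → Dec (Covered x row × Disjoint ts × Uncrossed row ts)
      point? x row ts =
        All.all? (λ y → (colour (inj₁ x) ≟C colour (inj₁ y)) ⊎-dec (List.length (through y row) ℕ.≟ 2)) points
        ×-dec (disjoint? ts
        ×-dec All.all? (λ (_ , t) → All.all? (λ (_ , u) → ¬? (contains? t (nestOf u))) row) ts)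

    module _ (valid : Valid table) where
      private
        ∈table : ∀ i → (i , entry i) ∈ˡ table
        ∈table i = ∈-tabulate⁺ i

        rainbow : ∀ i → Rainbow (entry i)
        rainbow i = All.lookup (proj₁ valid) (∈table i)

        has⁺ : ∀ {x t} → x ∈ᵇ corner t → Has x t
        has⁺ (zero , e)             = inj₁ (sym e)
        has⁺ (suc zero , e)         = inj₂ (inj₁ (sym e))
        has⁺ (suc (suc zero) , e)   = inj₂ (inj₂ (sym e))

        has⁻ : ∀ {x t} → Has x t → x ∈ᵇ corner t
        has⁻ (inj₁ e)        = zero , sym e
        has⁻ (inj₂ (inj₁ e)) = suc zero , sym e
        has⁻ (inj₂ (inj₂ e)) = suc (suc zero) , sym e

        at-point : ∀ x → Covered x (through x table) × Disjoint (nestedAt (inj₁ x) table)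
                         × Uncrossed (through x table) (nestedAt (inj₁ x) table)
        at-point x = All.lookup (proj₁ (proj₂ valid)) (∈points x)

        disjoint : ∀ y → Disjoint (nestedAt y table)
        disjoint (inj₁ x) = proj₁ (proj₂ (at-point x))
        disjoint (inj₂ y) = All.lookup (proj₂ (proj₂ valid)) (∈extras y)

        ∈nestedAt : ∀ {y} i → nestOf (entry i) ≡ y → (i , entry i) ∈ˡ nestedAt y table
        ∈nestedAt i e = ∈-filter⁺ _ (∈table i) e

        ∈through : ∀ {x} i → Has x (entry i) → (i , entry i) ∈ˡ through x table
        ∈through i h = ∈-filter⁺ _ (∈table i) h

        avoid : ∀ i j → colour (nestOf (entry i)) ≢ colour (inj₁ (corner (entry i) j))
        avoid i zero             = proj₁ (proj₂ (rainbow i))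
        avoid i (suc zero)       = proj₁ (proj₂ (proj₂ (rainbow i)))
        avoid i (suc (suc zero)) = proj₂ (proj₂ (proj₂ (rainbow i)))

        meet : ∀ {t u} i → Has (corner t i) u → Meets t u
        meet zero             h = inj₁ h
        meet (suc zero)       h = inj₂ (inj₁ h)
        meet (suc (suc zero)) h = inj₂ (inj₂ h)

        once : ∀ i k a b → corner (entry i) a ≡ corner (entry k) b → nestOf (entry i) ≡ nestOf (entry k) → i ≡ k
        once i k a b e₁ e₂ with All.lookup (All.lookup (disjoint (nestOf (entry k))) (∈nestedAt i e₂)) (∈nestedAt k refl)
        ... | inj₁ ¬m = ⊥-elim (¬m (meet {entry i} {entry k} a (has⁺ {t = entry k} (b , sym e₁))))
        ... | inj₂ eq = eq

        uncross : ∀ i k a b → inj₁ (corner (entry i) a) ≡ nestOf (entry k) → nestOf (entry i) ≡ inj₁ (corner (entry k) b) → ⊥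
        uncross i k a b e₁ e₂ = All.lookup (All.lookup (proj₂ (proj₂ (at-point (corner (entry i) a)))) (∈nestedAt k (sym e₁)))
          (∈through i (has⁺ {t = entry i} (a , refl))) (_ , e₂ , has⁺ {t = entry k} (b , refl))

        spread : ∀ t → Rainbow t → ∀ {i j} → i ≢ j → colour (inj₁ (corner t i)) ≢ colour (inj₁ (corner t j))
        spread t ((ab , ac , bc) , _) {zero}           {zero}           i≢j = ⊥-elim (i≢j refl)
        spread t ((ab , ac , bc) , _) {zero}           {suc zero}       i≢j = ab
        spread t ((ab , ac , bc) , _) {zero}           {suc (suc zero)} i≢j = ac
        spread t ((ab , ac , bc) , _) {suc zero}       {zero}           i≢j = ab ∘ sym
        spread t ((ab , ac , bc) , _) {suc zero}       {suc zero}       i≢j = ⊥-elim (i≢j refl)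
        spread t ((ab , ac , bc) , _) {suc zero}       {suc (suc zero)} i≢j = bc
        spread t ((ab , ac , bc) , _) {suc (suc zero)} {zero}           i≢j = ac ∘ sym
        spread t ((ab , ac , bc) , _) {suc (suc zero)} {suc zero}       i≢j = bc ∘ sym
        spread t ((ab , ac , bc) , _) {suc (suc zero)} {suc (suc zero)} i≢j = ⊥-elim (i≢j refl)

        cover : ∀ x y → colour (inj₁ x) ≢ colour (inj₁ y) → Twice λ i → x ∈ᵇ corner (entry i) × y ∈ᵇ corner (entry i)
        cover x y x≢y with All.lookup (proj₁ (at-point x)) (∈points y)
        ... | inj₁ eq  = ⊥-elim (x≢y eq)
        -- The list is generalised to a variable, so that its length 2 can be matched on.
        ... | inj₂ two = go _ refl two
          where
          joint : List (Fin N × Entry)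
          joint = List.filter (has? y ∘ proj₂) (List.filter (has? x ∘ proj₂) table)

          joint-unique : Unique joint
          joint-unique = Unique.filter⁺ _ (Unique.filter⁺ _ (Unique.tabulate⁺ (cong proj₁)))

          ∈joint : ∀ i → x ∈ᵇ corner (entry i) × y ∈ᵇ corner (entry i) → (i , entry i) ∈ˡ joint
          ∈joint i (p , q) = ∈-filter⁺ (has? y ∘ proj₂) (∈-filter⁺ (has? x ∘ proj₂) (∈table i) (has⁺ p)) (has⁺ q)

          joint⁻ : ∀ {i t} → (i , t) ∈ˡ joint → t ≡ entry i × x ∈ᵇ corner (entry i) × y ∈ᵇ corner (entry i)
          joint⁻ m with ∈-filter⁻ (has? y ∘ proj₂) {xs = List.filter (has? x ∘ proj₂) table} m
          ... | m′ , hy with ∈-filter⁻ (has? x ∘ proj₂) {xs = table} m′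
          ...   | m″ , hx with ∈-tabulate⁻ {f = λ i → i , entry i} m″
          ...     | _ , refl = refl , has⁻ hx , has⁻ hy

          go : ∀ l → l ≡ joint → List.length l ≡ 2 → Twice λ i → x ∈ᵇ corner (entry i) × y ∈ᵇ corner (entry i)
          go ((i , t) ∷ (j , u) ∷ []) eq _
            with joint⁻ (into (here refl)) | joint⁻ (into (there (here refl))) | subst Unique (sym eq) joint-unique
            where
            into : ∀ {e} → e ∈ˡ (i , t) ∷ (j , u) ∷ [] → e ∈ˡ joint
            into {e} = subst (e ∈ˡ_) eq
          ... | refl , hi | refl , hj | (ne All.∷ _) ∷ _ = i , j , (λ { refl → ne refl }) , hi , hj , only
            where
            only : ∀ k → x ∈ᵇ corner (entry k) × y ∈ᵇ corner (entry k) → k ≡ i ⊎ k ≡ j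
            only k h with subst ((k , entry k) ∈ˡ_) (sym eq) (∈joint k h)
            ... | here e         = inj₁ (cong proj₁ e)
            ... | there (here e) = inj₂ (cong proj₁ e)

      fromTable : Nested P Q colour
      fromTable = record
        { Block   = Fin N
        ; size    = N
        ; enum    = ↔-id _
        ; pt      = corner ∘ entry
        ; nest    = nestOf ∘ entry
        ; spread  = λ i → spread (entry i) (rainbow i)
        ; avoid   = avoid
        ; cover   = cover
        ; once    = λ {i} {k} {a} {b} → once i k a b
        ; uncross = λ {i} {k} {a} {b} → uncross i k a b
        }

-- Small designs and frames, given by base blocks and an automorphism.

Quad : Set
Quad = ℕ × ℕ × ℕ × ℕ

orbits : ℕ → (ℕ → ℕ) → List Quad → List Quad
orbits n ρ = List.concatMap λ q → List.iterate (λ (a , b , c , d) → ρ a , ρ b , ρ c , ρ d) q n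

-- x is rotated within {k (c + 1), ..., k (c + 1) + c}.
rotate : ℕ → ℕ → ℕ
rotate c x = if x % suc c <ᵇ c then suc x else x ∸ c

rotateBelow : ℕ → ℕ → ℕ
rotateBelow b x = if x <ᵇ b then rotate 2 x else x

-- x = c i + l is moved from the i-th to the next one of three classes of size c, from 3 c onwards it is fixed.
rotateClasses : (c : ℕ) → ℕ → ℕ
rotateClasses c x = if x <ᵇ 2 * c then c + x else (if x <ᵇ 3 * c then x ∸ 2 * c else x)

split : {P Q : Set} → ℕ → (ℕ → P) → (ℕ → Q) → Quad → P × P × P × (P ⊎ Q)
split v p q (a , b , c , d) = p a , p b , p c , (if d <ᵇ v then inj₁ (p d) else inj₂ (q (d ∸ v)))

module _ (v e : ℕ) where
  module StrongTable = Explicit {Fin (suc v)} {Fin (suc e)} F._≟_ F._≟_ (Sum.≡-dec F._≟_ F._≟_) id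
    (List.allFin (suc v)) ∈-allFin (List.allFin (suc e)) ∈-allFin

  strongEntries : List Quad → List StrongTable.Entry
  strongEntries = List.map (split (suc v) (_mod suc v) (_mod suc e))

module _ (g a b : ℕ) where
  module FrameTable = Explicit {Fin (suc g) × Fin (suc a)} {Fin (suc g) × Fin (suc b)}
    (Prod.≡-dec F._≟_ F._≟_) (Prod.≡-dec F._≟_ F._≟_) F._≟_ [ proj₁ , proj₁ ]′
    (List.cartesianProduct (List.allFin (suc g)) (List.allFin (suc a)))
    (λ (i , l) → ∈-cartesianProduct⁺ (∈-allFin i) (∈-allFin l))
    (List.cartesianProduct (List.allFin (suc g)) (List.allFin (suc b)))
    (λ (i , l) → ∈-cartesianProduct⁺ (∈-allFin i) (∈-allFin l))

  frameEntries : List Quad → List FrameTable.Entry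
  frameEntries = List.map (split (suc g * suc a) (λ x → (x / suc a) mod suc g , x mod suc a)
                                                 (λ x → (x / suc b) mod suc g , x mod suc b))

-- Found by computer search.  For 2 w = 3 v the number of unused pairs at every point is a multiple
-- of 3, which guided the choice of the v / 2 unused pairs for v = 24.
u₂ : U 2
u₂ = fromTable entries (from-yes (valid? entries (table entries)))
  where
  open StrongTable 11 5
  entries : List Entry
  entries = strongEntries 11 5 (orbits 3 (rotateBelow 15)
    ((10 , 6 , 4 , 16) ∷ (7 , 1 , 8 , 11) ∷ (3 , 10 , 1 , 9) ∷ (3 , 5 , 2 , 12) ∷ (11 , 3 , 6 , 2) ∷
     (6 , 0 , 3 , 14) ∷ (6 , 2 , 4 , 7) ∷ (6 , 9 , 7 , 13) ∷ (9 , 5 , 3 , 7) ∷ (9 , 2 , 11 , 14) ∷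
     (3 , 11 , 7 , 15) ∷ (8 , 4 , 0 , 2) ∷ (9 , 2 , 10 , 5) ∷ (11 , 0 , 8 , 17) ∷ [])
    -- A repeated block which the rotation fixes, with two different fixed nests.
    List.++ (0 , 1 , 2 , 15) ∷ (0 , 1 , 2 , 16) ∷ [])

u₃ : U 3
u₃ = fromTable entries (from-yes (valid? entries (table entries)))
  where
  open StrongTable 17 8
  entries : List Entry
  entries = strongEntries 17 8 (orbits 3 (rotateBelow 24)
    ((7 , 10 , 2 , 25) ∷ (16 , 0 , 13 , 14) ∷ (8 , 13 , 5 , 17) ∷ (3 , 2 , 7 , 21) ∷ (10 , 5 , 3 , 18) ∷
     (17 , 12 , 16 , 9) ∷ (8 , 1 , 5 , 21) ∷ (11 , 8 , 14 , 26) ∷ (11 , 6 , 0 , 12) ∷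
     (12 , 9 , 16 , 24) ∷ (11 , 17 , 3 , 23) ∷ (10 , 9 , 14 , 19) ∷ (16 , 8 , 1 , 6) ∷
     (11 , 4 , 13 , 0) ∷ (7 , 1 , 12 , 15) ∷ (10 , 9 , 0 , 6) ∷ (7 , 9 , 3 , 0) ∷ (7 , 14 , 13 , 22) ∷
     (11 , 15 , 7 , 5) ∷ (2 , 16 , 11 , 17) ∷ (11 , 16 , 17 , 21) ∷ (4 , 14 , 12 , 7) ∷
     (16 , 6 , 4 , 5) ∷ (12 , 0 , 2 , 18) ∷ (10 , 14 , 0 , 21) ∷ (3 , 1 , 13 , 11) ∷ (8 , 3 , 9 , 10) ∷
     (15 , 5 , 2 , 19) ∷ (0 , 15 , 5 , 26) ∷ (7 , 14 , 16 , 18) ∷ (17 , 14 , 5 , 25) ∷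
     (8 , 7 , 17 , 20) ∷ (17 , 0 , 3 , 1) ∷ [])
    List.++ (0 , 1 , 2 , 24) ∷ (3 , 4 , 5 , 24) ∷ (6 , 7 , 8 , 24) ∷ [])

frame-4⁴ : Frame (Fin 4) (Fin 4) (Fin 2)
frame-4⁴ = fromTable entries (from-yes (valid? entries (table entries)))
  where
  open FrameTable 3 3 1
  entries : List Entry
  entries = frameEntries 3 3 1 ((7 , 15 , 0 , 10) ∷ (4 , 8 , 2 , 22) ∷ (15 , 5 , 11 , 16) ∷ (2 , 9 , 13 , 6) ∷ (13 , 1 , 5 , 9) ∷
    (13 , 3 , 6 , 8) ∷ (9 , 13 , 2 , 18) ∷ (14 , 6 , 10 , 16) ∷ (6 , 15 , 8 , 17) ∷ (12 , 0 , 8 , 4) ∷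
    (2 , 11 , 12 , 19) ∷ (9 , 4 , 15 , 2) ∷ (15 , 5 , 3 , 21) ∷ (9 , 14 , 7 , 17) ∷ (5 , 2 , 14 , 10) ∷
    (5 , 2 , 10 , 13) ∷ (12 , 0 , 7 , 8) ∷ (8 , 5 , 13 , 1) ∷ (7 , 14 , 1 , 21) ∷ (6 , 2 , 15 , 11) ∷
    (13 , 1 , 10 , 4) ∷ (11 , 15 , 0 , 18) ∷ (7 , 3 , 13 , 20) ∷ (15 , 2 , 4 , 20) ∷
    (1 , 10 , 15 , 6) ∷ (9 , 5 , 0 , 15) ∷ (8 , 0 , 6 , 14) ∷ (11 , 13 , 4 , 17) ∷ (4 , 1 , 12 , 11) ∷
    (11 , 3 , 7 , 13) ∷ (14 , 9 , 3 , 19) ∷ (14 , 11 , 0 , 5) ∷ (1 , 6 , 9 , 12) ∷ (13 , 10 , 0 , 19) ∷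
    (10 , 0 , 4 , 23) ∷ (12 , 11 , 6 , 3) ∷ (4 , 14 , 10 , 3) ∷ (14 , 4 , 3 , 9) ∷ (12 , 2 , 6 , 21) ∷
    (12 , 1 , 5 , 20) ∷ (14 , 8 , 5 , 2) ∷ (5 , 12 , 10 , 17) ∷ (15 , 8 , 1 , 19) ∷ (10 , 2 , 7 , 12) ∷
    (2 , 14 , 11 , 7) ∷ (4 , 12 , 9 , 16) ∷ (2 , 7 , 8 , 23) ∷ (6 , 9 , 1 , 23) ∷ (1 , 8 , 14 , 18) ∷
    (5 , 11 , 3 , 23) ∷ (12 , 7 , 9 , 0) ∷ (3 , 4 , 8 , 15) ∷ (14 , 0 , 6 , 20) ∷ (3 , 10 , 12 , 18) ∷
    (13 , 0 , 4 , 21) ∷ (3 , 6 , 10 , 22) ∷ (13 , 11 , 6 , 0) ∷ (12 , 8 , 3 , 5) ∷ (15 , 3 , 9 , 7) ∷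
    (4 , 11 , 1 , 14) ∷ (0 , 5 , 9 , 22) ∷ (8 , 13 , 7 , 16) ∷ (10 , 15 , 7 , 1) ∷ (11 , 1 , 7 , 22) ∷ [])

frame-6⁴ : Frame (Fin 4) (Fin 6) (Fin 3)
frame-6⁴ = fromTable entries (from-yes (valid? entries (table entries)))
  where
  open FrameTable 3 5 2
  entries : List Entry
  -- The automorphism permutes three groups cyclically and fixes the fourth pointwise, extra points
  -- included.
  entries = frameEntries 3 5 2 (orbits 3 (λ x → if x <ᵇ 24 then rotateClasses 6 x else 24 + rotateClasses 3 (x ∸ 24))
    ((0 , 20 , 7 , 31) ∷ (15 , 5 , 19 , 9) ∷ (18 , 0 , 14 , 29) ∷ (10 , 14 , 1 , 33) ∷
     (3 , 22 , 6 , 12) ∷ (14 , 8 , 21 , 0) ∷ (19 , 13 , 2 , 29) ∷ (4 , 11 , 12 , 18) ∷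
     (22 , 2 , 12 , 10) ∷ (11 , 20 , 16 , 3) ∷ (13 , 9 , 4 , 21) ∷ (3 , 18 , 15 , 28) ∷
     (21 , 0 , 6 , 17) ∷ (23 , 15 , 3 , 7) ∷ (17 , 11 , 18 , 24) ∷ (9 , 21 , 5 , 14) ∷
     (18 , 8 , 0 , 15) ∷ (1 , 11 , 21 , 31) ∷ (5 , 12 , 8 , 20) ∷ (15 , 6 , 5 , 33) ∷
     (1 , 22 , 17 , 11) ∷ (12 , 23 , 6 , 24) ∷ (16 , 22 , 11 , 25) ∷ (23 , 14 , 8 , 25) ∷
     (9 , 16 , 2 , 23) ∷ (13 , 3 , 6 , 35) ∷ (16 , 23 , 10 , 5) ∷ (20 , 11 , 1 , 13) ∷
     (7 , 5 , 12 , 19) ∷ (21 , 15 , 10 , 24) ∷ (13 , 10 , 21 , 26) ∷ (9 , 20 , 0 , 32) ∷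
     (20 , 4 , 14 , 27) ∷ (11 , 2 , 19 , 14) ∷ (9 , 14 , 1 , 22) ∷ (12 , 4 , 7 , 34) ∷
     (20 , 9 , 2 , 16) ∷ (19 , 13 , 9 , 24) ∷ (13 , 22 , 2 , 27) ∷ (23 , 13 , 1 , 6) ∷
     (18 , 16 , 10 , 1) ∷ (9 , 5 , 14 , 34) ∷ (11 , 23 , 5 , 32) ∷ (10 , 12 , 19 , 25) ∷
     (2 , 10 , 17 , 35) ∷ (15 , 4 , 22 , 29) ∷ (1 , 18 , 13 , 8) ∷ (12 , 10 , 19 , 4) ∷ []))

u₆ : U 6
u₆ = fromTable entries (from-yes (valid? entries (table entries)))
  where
  open StrongTable 35 17
  entries : List Entry
  entries = strongEntries 35 17 (orbits 9 (λ x → if x <ᵇ 45 then rotate 8 x else rotate 2 x)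
    ((0 , 34 , 10 , 50) ∷ (17 , 33 , 25 , 50) ∷ (1 , 19 , 30 , 28) ∷ (18 , 1 , 4 , 36) ∷
     (7 , 22 , 9 , 21) ∷ (18 , 10 , 33 , 21) ∷ (2 , 11 , 7 , 10) ∷ (18 , 14 , 26 , 51) ∷
     (34 , 29 , 22 , 43) ∷ (19 , 12 , 23 , 2) ∷ (26 , 27 , 23 , 37) ∷ (11 , 0 , 20 , 4) ∷
     (4 , 0 , 25 , 15) ∷ (21 , 1 , 34 , 8) ∷ (27 , 1 , 17 , 43) ∷ (10 , 34 , 19 , 51) ∷
     (3 , 11 , 33 , 18) ∷ (14 , 5 , 32 , 46) ∷ (8 , 29 , 1 , 51) ∷ (34 , 0 , 18 , 13) ∷
     (30 , 35 , 13 , 31) ∷ (6 , 18 , 29 , 42) ∷ (14 , 34 , 35 , 11) ∷ (23 , 6 , 4 , 3) ∷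
     (18 , 12 , 11 , 40) ∷ (18 , 25 , 23 , 45) ∷ (15 , 5 , 20 , 39) ∷ (5 , 17 , 13 , 33) ∷
     (9 , 32 , 16 , 22) ∷ (32 , 6 , 29 , 44) ∷ (33 , 0 , 31 , 46) ∷ (2 , 17 , 3 , 27) ∷
     (34 , 20 , 28 , 36) ∷ (23 , 17 , 1 , 49) ∷ (0 , 25 , 13 , 30) ∷ (16 , 12 , 13 , 43) ∷
     (7 , 10 , 12 , 44) ∷ (35 , 15 , 25 , 6) ∷ (25 , 14 , 24 , 16) ∷ (3 , 34 , 32 , 21) ∷
     (27 , 17 , 22 , 30) ∷ (0 , 1 , 23 , 40) ∷ (3 , 31 , 22 , 49) ∷ (15 , 32 , 33 , 1) ∷
     (23 , 32 , 20 , 25) ∷ (0 , 27 , 15 , 51) ∷ [])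
    -- Blocks stabilised by the third power of the rotation. Their orbits have only three members
    -- and are listed in full; the nests run through a cycle of length 3.
    List.++ (0 , 3 , 6 , 45) ∷ (1 , 4 , 7 , 46) ∷ (2 , 5 , 8 , 47) ∷ (9 , 12 , 15 , 45) ∷ (10 , 13 , 16 , 46) ∷
    (11 , 14 , 17 , 47) ∷ [])

u₄ : U 4
u₄ = fromTable entries (from-yes (valid? entries (table entries)))
  where
  open StrongTable 23 11
  entries : List Entry
  entries = strongEntries 23 11 (orbits 3 (rotateBelow 33)
    ((20 , 5 , 21 , 17) ∷ (1 , 16 , 4 , 15) ∷ (21 , 1 , 11 , 19) ∷ (22 , 14 , 6 , 34) ∷
     (18 , 23 , 11 , 31) ∷ (19 , 5 , 14 , 30) ∷ (0 , 8 , 16 , 9) ∷ (14 , 8 , 10 , 12) ∷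
     (9 , 4 , 15 , 28) ∷ (3 , 23 , 5 , 13) ∷ (0 , 18 , 6 , 12) ∷ (13 , 0 , 6 , 4) ∷ (4 , 8 , 6 , 31) ∷
     (8 , 4 , 15 , 26) ∷ (19 , 16 , 4 , 33) ∷ (9 , 3 , 8 , 7) ∷ (2 , 23 , 21 , 4) ∷ (21 , 7 , 2 , 31) ∷
     (22 , 19 , 7 , 28) ∷ (0 , 15 , 20 , 34) ∷ (1 , 3 , 2 , 29) ∷ (12 , 4 , 1 , 9) ∷
     (22 , 5 , 23 , 26) ∷ (19 , 21 , 20 , 12) ∷ (1 , 13 , 22 , 31) ∷ (16 , 6 , 17 , 26) ∷
     (1 , 13 , 2 , 25) ∷ (20 , 16 , 13 , 27) ∷ (10 , 17 , 11 , 32) ∷ (17 , 22 , 14 , 29) ∷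
     (7 , 11 , 20 , 1) ∷ (6 , 19 , 3 , 18) ∷ (0 , 20 , 16 , 3) ∷ (18 , 5 , 9 , 35) ∷ (17 , 23 , 4 , 7) ∷
     (17 , 8 , 12 , 1) ∷ (8 , 19 , 5 , 27) ∷ (13 , 10 , 8 , 24) ∷ (10 , 1 , 3 , 26) ∷
     (22 , 16 , 12 , 7) ∷ (10 , 18 , 2 , 7) ∷ (6 , 22 , 2 , 35) ∷ (23 , 8 , 11 , 28) ∷
     (23 , 6 , 15 , 19) ∷ (10 , 21 , 17 , 22) ∷ (14 , 20 , 12 , 15) ∷ (20 , 9 , 17 , 11) ∷
     (20 , 6 , 2 , 23) ∷ (1 , 20 , 15 , 32) ∷ (9 , 4 , 14 , 22) ∷ (4 , 5 , 12 , 11) ∷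
     (23 , 10 , 20 , 25) ∷ (14 , 15 , 5 , 31) ∷ (10 , 2 , 12 , 28) ∷ (19 , 20 , 13 , 26) ∷
     (12 , 22 , 11 , 33) ∷ (10 , 0 , 4 , 20) ∷ (7 , 13 , 10 , 15) ∷ (15 , 10 , 1 , 21) ∷
     (14 , 23 , 16 , 1) ∷ [])
    List.++ (6 , 7 , 8 , 33) ∷ (9 , 10 , 11 , 34) ∷ (12 , 13 , 14 , 35) ∷ (15 , 16 , 17 , 35) ∷ [])


-- The integers modulo m.

module Modular (m-1 : ℕ) where
  private m = suc m-1

  e : ℕ → Fin m
  e n = n mod m

  toℕ-e : ∀ n → toℕ (e n) ≡ n % m
  toℕ-e n = F.toℕ-fromℕ< _

  e≡ : ∀ a b → a % m ≡ b % m → e a ≡ e b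
  e≡ a b eq = F.toℕ-injective (trans (toℕ-e a) (trans eq (sym (toℕ-e b))))

  e-toℕ : ∀ x → e (toℕ x) ≡ x
  e-toℕ x = F.toℕ-injective (trans (toℕ-e (toℕ x)) (DivMod.m<n⇒m%n≡m (F.toℕ<n x)))

  e-periodic : ∀ k a → e (a + k * m) ≡ e a
  e-periodic k a = e≡ (a + k * m) a (DivMod.[m+kn]%n≡m%n a k m)

  infixl 6 _⊕_
  infixl 7 _⊗_
  _⊕_ _⊗_ : Fin m → Fin m → Fin m
  x ⊕ y = e (toℕ x + toℕ y)
  x ⊗ y = e (toℕ x * toℕ y)

  ⊖_ : Fin m → Fin m
  ⊖ x = e (m ∸ toℕ x)

  e-+ : ∀ a b → e a ⊕ e b ≡ e (a + b)
  e-+ a b = e≡ (toℕ (e a) + toℕ (e b)) (a + b)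
    (trans (cong₂ (λ x y → (x + y) % m) (toℕ-e a) (toℕ-e b)) (sym (DivMod.%-distribˡ-+ a b m)))

  e-* : ∀ a b → e a ⊗ e b ≡ e (a * b)
  e-* a b = e≡ (toℕ (e a) * toℕ (e b)) (a * b)
    (trans (cong₂ (λ x y → (x * y) % m) (toℕ-e a) (toℕ-e b)) (sym (DivMod.%-distribˡ-* a b m)))

  private
    -- `e` is a surjective homomorphism from ℕ, so an identity need only be checked on its values,
    -- where it reduces to one of ℕ.
    lift₁ : (f g : Fin m → Fin m) → (∀ a → f (e a) ≡ g (e a)) → ∀ x → f x ≡ g x
    lift₁ f g h x = subst (λ x → f x ≡ g x) (e-toℕ x) (h (toℕ x))

    lift₂ : (f g : Fin m → Fin m → Fin m) → (∀ a b → f (e a) (e b) ≡ g (e a) (e b)) → ∀ x y → f x y ≡ g x y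
    lift₂ f g h x = lift₁ (f x) (g x) λ b → lift₁ (λ x → f x (e b)) (λ x → g x (e b)) (λ a → h a b) x

    lift₃ : (f g : Fin m → Fin m → Fin m → Fin m) → (∀ a b c → f (e a) (e b) (e c) ≡ g (e a) (e b) (e c)) →
            ∀ x y z → f x y z ≡ g x y z
    lift₃ f g h x y = lift₁ (f x y) (g x y) λ c → lift₂ (λ x y → f x y (e c)) (λ x y → g x y (e c)) (λ a b → h a b c) x y

  isCommutativeRing : IsCommutativeRing _≡_ _⊕_ _⊗_ ⊖_ (e 0) (e 1)
  isCommutativeRing = record
      { isRing = record
        { +-isAbelianGroup = record
          { isGroup = record
            { isMonoid = record
              { isSemigroup = record
                { isMagma = record { isEquivalence = isEquivalence ; ∙-cong = cong₂ _⊕_ }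
                ; assoc = lift₃ _ _ λ a b c → trans (cong (_⊕ e c) (e-+ a b)) (trans (e-+ (a + b) c)
                    (trans (cong e (ℕ.+-assoc a b c)) (sym (trans (cong (e a ⊕_) (e-+ b c)) (e-+ a (b + c)))))) }
              ; identity = lift₁ _ _ (λ a → e-+ 0 a) , lift₁ _ _ (λ a → trans (e-+ a 0) (cong e (ℕ.+-identityʳ a))) }
            ; inverse = (λ x → trans (+-comm′ (⊖ x) x) (inv x)) , inv
            ; ⁻¹-cong = cong ⊖_ }
          ; comm = +-comm′ }
        ; *-cong = cong₂ _⊗_
        ; *-assoc = lift₃ _ _ λ a b c → trans (cong (_⊗ e c) (e-* a b)) (trans (e-* (a * b) c)
            (trans (cong e (ℕ.*-assoc a b c)) (sym (trans (cong (e a ⊗_) (e-* b c)) (e-* a (b * c))))))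
        ; *-identity = lift₁ _ _ (λ a → trans (e-* 1 a) (cong e (ℕ.*-identityˡ a)))
                     , lift₁ _ _ (λ a → trans (e-* a 1) (cong e (ℕ.*-identityʳ a)))
        ; distrib = distribˡ , λ x y z → trans (*-comm′ (y ⊕ z) x)
                      (trans (distribˡ x y z) (cong₂ _⊕_ (*-comm′ x y) (*-comm′ x z))) }
      ; *-comm = *-comm′ }
    where
    +-comm′ : ∀ x y → x ⊕ y ≡ y ⊕ x
    +-comm′ x y = cong e (ℕ.+-comm (toℕ x) (toℕ y))

    *-comm′ : ∀ x y → x ⊗ y ≡ y ⊗ x
    *-comm′ x y = cong e (ℕ.*-comm (toℕ x) (toℕ y))

    inv : ∀ x → x ⊕ ⊖ x ≡ e 0
    inv x = trans (cong (_⊕ ⊖ x) (sym (e-toℕ x))) (trans (e-+ (toℕ x) (m ∸ toℕ x))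
      (trans (cong e (trans (ℕ.m+[n∸m]≡n (ℕ.<⇒≤ (F.toℕ<n x))) (sym (ℕ.+-identityʳ m)))) (e-periodic 1 0)))

    distribˡ : ∀ x y z → x ⊗ (y ⊕ z) ≡ x ⊗ y ⊕ x ⊗ z
    distribˡ = lift₃ _ _ λ a b c → trans (cong (e a ⊗_) (e-+ b c)) (trans (e-* a (b + c))
      (trans (cong e (ℕ.*-distribˡ-+ a b c)) (sym (trans (cong₂ _⊕_ (e-* a b) (e-* a c)) (e-+ (a * b) (a * c))))))

-- Finite rings with a half system, and the expressions s + c x over them.

module FinRing {q : ℕ} {_⊕_ _⊗_ : Fin q → Fin q → Fin q} {⊖_ : Fin q → Fin q} {𝟘 𝟙 : Fin q}
               (isCommutativeRing : IsCommutativeRing _≡_ _⊕_ _⊗_ ⊖_ 𝟘 𝟙) where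

  commutativeRing : CommutativeRing 0ℓ 0ℓ
  commutativeRing = record { isCommutativeRing = isCommutativeRing }

  module R = CommutativeRing commutativeRing
  module G = GroupProperties R.+-group
  module RP = RingProperties R.ring

  Unit : Fin q → Set
  Unit x = ∃ λ u → u ⊗ x ≡ 𝟙

  𝟙-unit : Unit 𝟙
  𝟙-unit = 𝟙 , R.*-identityˡ 𝟙

  ⊖-unit : ∀ {x} → Unit x → Unit (⊖ x)
  ⊖-unit {x} (u , eq) = ⊖ u , trans (sym (RP.-‿distribˡ-* u (⊖ x)))
    (trans (cong ⊖_ (sym (RP.-‿distribʳ-* u x))) (trans (G.⁻¹-involutive (u ⊗ x)) eq))

  unit-cancel : ∀ {δ x y} → Unit δ → δ ⊗ x ≡ δ ⊗ y → x ≡ y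
  unit-cancel {δ} {x} {y} (u , eq) e = trans (sym (undo x)) (trans (cong (u ⊗_) e) (undo y))
    where
    undo : ∀ z → u ⊗ (δ ⊗ z) ≡ z
    undo z = trans (sym (R.*-assoc u δ z)) (trans (cong (_⊗ z) eq) (R.*-identityˡ z))

  unit-divide : ∀ {δ} → Unit δ → ∀ z → ∃ λ x → δ ⊗ x ≡ z
  unit-divide {δ} (u , eq) z = u ⊗ z , trans (sym (R.*-assoc δ u z))
    (trans (cong (_⊗ z) (trans (R.*-comm δ u) eq)) (R.*-identityˡ z))

-- The unit conditions make all differences of the coefficients 1, -1, β, -β units; the image of ρ
-- contains exactly one of x and -x for each x ≢ 𝟘.
record HalvedRing (q : ℕ) : Set where
  infixl 6 _⊕_
  infixl 7 _⊗_
  infix 8 ⊖_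
  field
    _⊕_ _⊗_ : Fin q → Fin q → Fin q
    ⊖_      : Fin q → Fin q
    𝟘 𝟙     : Fin q
    isCommutativeRing : IsCommutativeRing _≡_ _⊕_ _⊗_ ⊖_ 𝟘 𝟙

  open FinRing isCommutativeRing public

  field
    β γ         : Fin q
    𝟙⊕γ         : 𝟙 ⊕ γ ≡ β
    𝟚-unit      : Unit (𝟙 ⊕ 𝟙)
    β-unit      : Unit β
    γ-unit      : Unit γ
    β+1-unit    : Unit (β ⊕ 𝟙)
    r           : ℕ
    ρ           : Fin r → Fin q
    halves      : ∀ x → x ≢ 𝟘 → ∃ λ k → x ≡ ρ k ⊎ x ⊕ ρ k ≡ 𝟘
    disjoint    : ∀ k l → ρ k ⊕ ρ l ≢ 𝟘
    ρ-injective : ∀ {k l} → ρ k ≡ ρ l → k ≡ l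

data Coef : Set where
  +1c -1c +βc -βc : Coef

negate : Coef → Coef
negate +1c = -1c
negate -1c = +1c
negate +βc = -βc
negate -βc = +βc

-- In each case d′ - c′ = -(d - c) in every ring.
Opposite : Coef × Coef → Coef × Coef → Set
Opposite (c , d) (c′ , d′) = (c′ ≡ d × d′ ≡ c) ⊎ (c′ ≡ negate c × d′ ≡ negate d)

module Lines {q : ℕ} (H : HalvedRing q) where
  open HalvedRing H
  ⟦_⟧ : Coef → Fin q
  ⟦ +1c ⟧ = 𝟙
  ⟦ -1c ⟧ = ⊖ 𝟙
  ⟦ +βc ⟧ = β
  ⟦ -βc ⟧ = ⊖ β

  ⟦⟧⊕negate : ∀ c → ⟦ c ⟧ ⊕ ⟦ negate c ⟧ ≡ 𝟘
  ⟦⟧⊕negate +1c = R.-‿inverseʳ 𝟙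
  ⟦⟧⊕negate -1c = R.-‿inverseˡ 𝟙
  ⟦⟧⊕negate +βc = R.-‿inverseʳ β
  ⟦⟧⊕negate -βc = R.-‿inverseˡ β

  opposite-sum : ∀ {c d c′ d′} → Opposite (c , d) (c′ , d′) → ⟦ c ⟧ ⊕ ⟦ c′ ⟧ ≡ ⟦ d ⟧ ⊕ ⟦ d′ ⟧
  opposite-sum {c} {d} (inj₁ (refl , refl)) = R.+-comm ⟦ c ⟧ ⟦ d ⟧
  opposite-sum {c} {d} (inj₂ (refl , refl)) = trans (⟦⟧⊕negate c) (sym (⟦⟧⊕negate d))

  coef-unit : ∀ c → Unit ⟦ c ⟧
  coef-unit +1c = 𝟙-unit
  coef-unit -1c = ⊖-unit 𝟙-unit
  coef-unit +βc = β-unit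
  coef-unit -βc = ⊖-unit β-unit

  β+β-unit : Unit (β ⊕ β)
  β+β-unit = u ⊗ v , (begin
    (u ⊗ v) ⊗ (β ⊕ β)         ≡⟨ cong ((u ⊗ v) ⊗_)
                                   (sym (trans (R.distribʳ β 𝟙 𝟙) (cong₂ _⊕_ (R.*-identityˡ β) (R.*-identityˡ β)))) ⟩
    (u ⊗ v) ⊗ ((𝟙 ⊕ 𝟙) ⊗ β)   ≡⟨ cong ((u ⊗ v) ⊗_) (R.*-comm (𝟙 ⊕ 𝟙) β) ⟩
    (u ⊗ v) ⊗ (β ⊗ (𝟙 ⊕ 𝟙))   ≡⟨ R.*-assoc u v _ ⟩
    u ⊗ (v ⊗ (β ⊗ (𝟙 ⊕ 𝟙)))   ≡⟨ cong (u ⊗_) (sym (R.*-assoc v β (𝟙 ⊕ 𝟙))) ⟩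
    u ⊗ ((v ⊗ β) ⊗ (𝟙 ⊕ 𝟙))   ≡⟨ cong (λ x → u ⊗ (x ⊗ (𝟙 ⊕ 𝟙))) (proj₂ β-unit) ⟩
    u ⊗ (𝟙 ⊗ (𝟙 ⊕ 𝟙))         ≡⟨ cong (u ⊗_) (R.*-identityˡ _) ⟩
    u ⊗ (𝟙 ⊕ 𝟙)               ≡⟨ proj₂ 𝟚-unit ⟩
    𝟙                         ∎)
    where
    open ≡-Reasoning
    u = proj₁ 𝟚-unit
    v = proj₁ β-unit

  Difference : Coef → Coef → Set
  Difference c d = ∃ λ δ → ⟦ c ⟧ ⊕ δ ≡ ⟦ d ⟧ × Unit δ

  reverse : ∀ {c d} → Difference c d → Difference d c
  reverse {c} {d} (δ , eq , u) = ⊖ δ , trans (cong (_⊕ ⊖ δ) (sym eq)) (G.//-rightDividesʳ δ ⟦ c ⟧) , ⊖-unit u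

  -- Up to sign the differences of ±1 and ±β are 2, β - 1, β + 1 and 2 β; `reverse` supplies the
  -- other sign.
  difference : ∀ {c d} → c ≢ d → Difference c d
  difference { -1c} {+1c} _ = 𝟙 ⊕ 𝟙 , G.\\-leftDividesʳ 𝟙 𝟙 , 𝟚-unit
  difference {+1c} {+βc} _ = γ , 𝟙⊕γ , γ-unit
  difference { -βc} {+1c} _ = β ⊕ 𝟙 , G.\\-leftDividesʳ β 𝟙 , β+1-unit
  difference { -1c} {+βc} _ = β ⊕ 𝟙 , trans (cong (⊖ 𝟙 ⊕_) (R.+-comm β 𝟙)) (G.\\-leftDividesʳ 𝟙 β) , β+1-unit
  difference { -βc} { -1c} _ = γ , G.∙-cancelˡ β _ _ (begin
    β ⊕ (⊖ β ⊕ γ)  ≡⟨ G.\\-leftDividesˡ β γ ⟩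
    γ              ≡⟨ sym (G.//-rightDividesʳ 𝟙 γ) ⟩
    γ ⊕ 𝟙 ⊕ ⊖ 𝟙    ≡⟨ cong (_⊕ ⊖ 𝟙) (trans (R.+-comm γ 𝟙) 𝟙⊕γ) ⟩
    β ⊕ ⊖ 𝟙        ∎) , γ-unit
    where open ≡-Reasoning
  difference { -βc} {+βc} _ = β ⊕ β , G.\\-leftDividesʳ β β , β+β-unit
  difference {+1c} { -1c} c≢d = reverse { -1c} {+1c} (difference (c≢d ∘ sym))
  difference {+βc} {+1c} c≢d = reverse {+1c} {+βc} (difference (c≢d ∘ sym))
  difference {+1c} { -βc} c≢d = reverse { -βc} {+1c} (difference (c≢d ∘ sym))
  difference {+βc} { -1c} c≢d = reverse { -1c} {+βc} (difference (c≢d ∘ sym))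
  difference { -1c} { -βc} c≢d = reverse { -βc} { -1c} (difference (c≢d ∘ sym))
  difference {+βc} { -βc} c≢d = reverse { -βc} {+βc} (difference (c≢d ∘ sym))
  difference {+1c} {+1c} c≢d = ⊥-elim (c≢d refl)
  difference { -1c} { -1c} c≢d = ⊥-elim (c≢d refl)
  difference {+βc} {+βc} c≢d = ⊥-elim (c≢d refl)
  difference { -βc} { -βc} c≢d = ⊥-elim (c≢d refl)

  val : Coef → Fin q → Fin r → Fin q
  val c s k = s ⊕ ⟦ c ⟧ ⊗ ρ k

  val-shift : ∀ {c d δ} → ⟦ c ⟧ ⊕ δ ≡ ⟦ d ⟧ → ∀ s k → val c s k ⊕ δ ⊗ ρ k ≡ val d s k
  val-shift {c} {d} {δ} eq s k = trans (R.+-assoc s _ _)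
    (cong (s ⊕_) (trans (sym (R.distribʳ (ρ k) ⟦ c ⟧ δ)) (cong (_⊗ ρ k) eq)))

  ρ≢𝟘 : ∀ k → ρ k ≢ 𝟘
  ρ≢𝟘 k eq = disjoint k k (trans (cong₂ _⊕_ eq eq) (R.+-identityˡ 𝟘))

  unit⊗ρ≢𝟘 : ∀ {δ} → Unit δ → ∀ k → δ ⊗ ρ k ≢ 𝟘
  unit⊗ρ≢𝟘 {δ} u k eq = ρ≢𝟘 k (unit-cancel u (trans eq (sym (R.zeroʳ δ))))

  val≢base : ∀ c s k → val c s k ≢ s
  val≢base c s k eq = unit⊗ρ≢𝟘 (coef-unit c) k (G.identityʳ-unique s _ eq)

  val-spread : ∀ {c d} → c ≢ d → ∀ s k → val c s k ≢ val d s k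
  val-spread {c} {d} c≢d s k eq with difference c≢d
  ... | δ , e , u = unit⊗ρ≢𝟘 u k (G.identityʳ-unique (val c s k) _ (trans (val-shift {c} {d} e s k) (sym eq)))

  val-injective : ∀ c s {k l} → val c s k ≡ val c s l → k ≡ l
  val-injective c s eq = ρ-injective (unit-cancel (coef-unit c) (G.∙-cancelˡ s _ _ eq))

  -- Subtracting the two equations leaves δ x with δ a unit, which fixes x and then s.
  val-unique : ∀ {c d} → c ≢ d → ∀ {s t k l} → val c s k ≡ val c t l → val d s k ≡ val d t l → s ≡ t × k ≡ l
  val-unique {c} {d} c≢d {s} {t} {k} {l} e₁ e₂ with difference c≢d
  ... | δ , e , u = G.∙-cancelʳ (⟦ c ⟧ ⊗ ρ k) s t (trans e₁ (cong (λ k → val c t k) (sym k≡l))) , k≡l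
    where
    k≡l : k ≡ l
    k≡l = ρ-injective (unit-cancel u (G.∙-cancelˡ (val c s k) _ _
      (trans (val-shift {c} {d} e s k) (trans e₂ (trans (sym (val-shift {c} {d} e t l)) (cong (_⊕ δ ⊗ ρ l) (sym e₁)))))))

  opposite-δ : ∀ {c d c′ d′} → Opposite (c , d) (c′ , d′) → ((δ , _) : Difference c d) →
               ∃ λ δ′ → ⟦ c′ ⟧ ⊕ δ′ ≡ ⟦ d′ ⟧ × δ ⊕ δ′ ≡ 𝟘
  opposite-δ {c} {d} {c′} {d′} o (δ , e , u) = ⊖ δ , G.∙-cancelˡ ⟦ d ⟧ _ _ (begin
      ⟦ d ⟧ ⊕ (⟦ c′ ⟧ ⊕ ⊖ δ)  ≡⟨ sym (R.+-assoc ⟦ d ⟧ ⟦ c′ ⟧ (⊖ δ)) ⟩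
      ⟦ d ⟧ ⊕ ⟦ c′ ⟧ ⊕ ⊖ δ    ≡⟨ cong (λ x → x ⊕ ⟦ c′ ⟧ ⊕ ⊖ δ) (sym e) ⟩
      ⟦ c ⟧ ⊕ δ ⊕ ⟦ c′ ⟧ ⊕ ⊖ δ ≡⟨ cong (_⊕ ⊖ δ) (trans (R.+-assoc ⟦ c ⟧ δ ⟦ c′ ⟧)
                                  (trans (cong (⟦ c ⟧ ⊕_) (R.+-comm δ ⟦ c′ ⟧)) (sym (R.+-assoc ⟦ c ⟧ ⟦ c′ ⟧ δ)))) ⟩
      ⟦ c ⟧ ⊕ ⟦ c′ ⟧ ⊕ δ ⊕ ⊖ δ ≡⟨ G.//-rightDividesʳ δ _ ⟩
      ⟦ c ⟧ ⊕ ⟦ c′ ⟧          ≡⟨ opposite-sum o ⟩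
      ⟦ d ⟧ ⊕ ⟦ d′ ⟧          ∎) , R.-‿inverseʳ δ
    where open ≡-Reasoning

  Joins : Coef → Coef → Fin q → Fin q → Fin q × Fin r → Set
  Joins c d g h (s , k) = val c s k ≡ g × val d s k ≡ h

  -- The quotient x = (h - g) / δ is nonzero, so x or -x lies in the half system. In the second case
  -- the opposite difference -δ together with -x gives the same h - g.
  join-one : ∀ {c d c′ d′} → Opposite (c , d) (c′ , d′) → c ≢ d → ∀ {g h} → g ≢ h →
             (∃ λ b → Joins c d g h b) ⊎ (∃ λ b → Joins c′ d′ g h b)
  join-one {c} {d} {c′} {d′} o c≢d {g} {h} g≢h with difference c≢d
  ... | D@(δ , e , u) with unit-divide u (⊖ g ⊕ h) | opposite-δ o D
  ...   | x , δx | δ′ , e′ , δ+δ′ with halves x (λ { refl → g≢h (G.∙-cancelˡ (⊖ g) g h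
              (trans (R.-‿inverseˡ g) (trans (sym (R.zeroʳ δ)) δx))) })
  ...     | k , inj₁ refl = inj₁ ((g ⊕ ⊖ (⟦ c ⟧ ⊗ ρ k) , k) , at-c
              , trans (sym (val-shift {c} {d} e _ k)) (trans (cong₂ _⊕_ at-c δx) (G.\\-leftDividesˡ g h)))
    where at-c = G.//-rightDividesˡ (⟦ c ⟧ ⊗ ρ k) g
  ...     | k , inj₂ x+ρk = inj₂ ((g ⊕ ⊖ (⟦ c′ ⟧ ⊗ ρ k) , k) , at-c
              , trans (sym (val-shift {c′} {d′} e′ _ k)) (trans (cong₂ _⊕_ at-c δ′ρ) (G.\\-leftDividesˡ g h)))
    where
    at-c = G.//-rightDividesˡ (⟦ c′ ⟧ ⊗ ρ k) g
    δ′ρ : δ′ ⊗ ρ k ≡ ⊖ g ⊕ h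
    δ′ρ = trans (G.∙-cancelˡ (δ ⊗ ρ k) _ _ (begin
        δ ⊗ ρ k ⊕ δ′ ⊗ ρ k  ≡⟨ sym (R.distribʳ (ρ k) δ δ′) ⟩
        (δ ⊕ δ′) ⊗ ρ k      ≡⟨ cong (_⊗ ρ k) δ+δ′ ⟩
        𝟘 ⊗ ρ k             ≡⟨ R.zeroˡ (ρ k) ⟩
        𝟘                   ≡⟨ sym (R.zeroʳ δ) ⟩
        δ ⊗ 𝟘               ≡⟨ cong (δ ⊗_) (sym (trans (R.+-comm (ρ k) x) x+ρk)) ⟩
        δ ⊗ (ρ k ⊕ x)       ≡⟨ R.distribˡ δ (ρ k) x ⟩
        δ ⊗ ρ k ⊕ δ ⊗ x     ∎)) δx
      where open ≡-Reasoning

  -- Two solutions would give δ ρ k = - δ ρ l, hence ρ k + ρ l = 0, which the half system excludes.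
  join-not-both : ∀ {c d c′ d′} → Opposite (c , d) (c′ , d′) → c ≢ d → ∀ {g h b b′} → Joins c d g h b → Joins c′ d′ g h b′ → ⊥
  join-not-both {c} {d} {c′} {d′} o c≢d {b = s , k} {t , l} (e₁ , e₂) (e₃ , e₄) with difference c≢d
  ... | D@(δ , e , u) with opposite-δ o D
  ...   | δ′ , e′ , δ+δ′ = disjoint k l (unit-cancel u (begin
      δ ⊗ (ρ k ⊕ ρ l)      ≡⟨ R.distribˡ δ (ρ k) (ρ l) ⟩
      δ ⊗ ρ k ⊕ δ ⊗ ρ l    ≡⟨ cong (_⊕ δ ⊗ ρ l) δρ≡ ⟩
      δ′ ⊗ ρ l ⊕ δ ⊗ ρ l   ≡⟨ sym (R.distribʳ (ρ l) δ′ δ) ⟩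
      (δ′ ⊕ δ) ⊗ ρ l       ≡⟨ cong (_⊗ ρ l) (trans (R.+-comm δ′ δ) δ+δ′) ⟩
      𝟘 ⊗ ρ l              ≡⟨ R.zeroˡ (ρ l) ⟩
      𝟘                    ≡⟨ sym (R.zeroʳ δ) ⟩
      δ ⊗ 𝟘                ∎))
    where
    open ≡-Reasoning
    δρ≡ : δ ⊗ ρ k ≡ δ′ ⊗ ρ l
    δρ≡ = G.∙-cancelˡ (val c s k) _ _ (trans (val-shift {c} {d} e s k) (trans e₂ (trans (sym e₄)
            (trans (sym (val-shift {c′} {d′} e′ t l)) (cong (_⊕ δ′ ⊗ ρ l) (trans e₃ (sym e₁)))))))

  ⟦⟧⊗-sum≢𝟘 : ∀ c k l → ⟦ c ⟧ ⊗ ρ k ⊕ ⟦ c ⟧ ⊗ ρ l ≢ 𝟘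
  ⟦⟧⊗-sum≢𝟘 c k l eq = disjoint k l (unit-cancel (coef-unit c)
    (trans (R.distribˡ ⟦ c ⟧ (ρ k) (ρ l)) (trans eq (sym (R.zeroʳ ⟦ c ⟧)))))

  val-negate : ∀ c s k l → val c s k ≢ val (negate c) s l
  val-negate c s k l eq = ⟦⟧⊗-sum≢𝟘 c k l (begin
    ⟦ c ⟧ ⊗ ρ k ⊕ ⟦ c ⟧ ⊗ ρ l            ≡⟨ cong (_⊕ ⟦ c ⟧ ⊗ ρ l) (G.∙-cancelˡ s _ _ eq) ⟩
    ⟦ negate c ⟧ ⊗ ρ l ⊕ ⟦ c ⟧ ⊗ ρ l     ≡⟨ sym (R.distribʳ (ρ l) _ _) ⟩
    (⟦ negate c ⟧ ⊕ ⟦ c ⟧) ⊗ ρ l         ≡⟨ cong (_⊗ ρ l) (trans (R.+-comm _ ⟦ c ⟧) (⟦⟧⊕negate c)) ⟩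
    𝟘 ⊗ ρ l                              ≡⟨ R.zeroˡ (ρ l) ⟩
    𝟘                                    ∎)
    where open ≡-Reasoning

  val-cross : ∀ c {s t} k l → val c s k ≡ t → val c t l ≡ s → ⊥
  val-cross c {s} k l refl eq = ⟦⟧⊗-sum≢𝟘 c k l (G.identityʳ-unique s _ (trans (sym (R.+-assoc s _ _)) eq))

-- Linear frames: one table of levels and coefficients for all rings.

_≟ᶜ_ : DecidableEquality Coef
+1c ≟ᶜ +1c = yes refl
+1c ≟ᶜ -1c = no λ ()
+1c ≟ᶜ +βc = no λ ()
+1c ≟ᶜ -βc = no λ ()
-1c ≟ᶜ +1c = no λ ()
-1c ≟ᶜ -1c = yes refl
-1c ≟ᶜ +βc = no λ ()
-1c ≟ᶜ -βc = no λ ()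
+βc ≟ᶜ +1c = no λ ()
+βc ≟ᶜ -1c = no λ ()
+βc ≟ᶜ +βc = yes refl
+βc ≟ᶜ -βc = no λ ()
-βc ≟ᶜ +1c = no λ ()
-βc ≟ᶜ -1c = no λ ()
-βc ≟ᶜ +βc = no λ ()
-βc ≟ᶜ -βc = yes refl

-- An entry with corners (lᵢ , cᵢ) and nest n stands for all the blocks
-- {(s + c₁ x , l₁) , (s + c₂ x , l₂) , (s + c₃ x , l₃)} nested at (s , n), with s in the ring
-- and x in the half system.
module Linear (ℓ ε : ℕ) where

  Entry : Set
  Entry = (Fin ℓ × Coef) × (Fin ℓ × Coef) × (Fin ℓ × Coef) × (Fin ℓ ⊎ Fin ε)

  corner : Entry → Fin 3 → Fin ℓ × Coef
  corner (a , b , c , _) zero             = a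
  corner (a , b , c , _) (suc zero)       = b
  corner (a , b , c , _) (suc (suc zero)) = c

  lev : Entry → Fin 3 → Fin ℓ
  lev t x = proj₁ (corner t x)

  coef : Entry → Fin 3 → Coef
  coef t x = proj₂ (corner t x)

  nestOf : Entry → Fin ℓ ⊎ Fin ε
  nestOf (_ , _ , _ , n) = n

  _≟ⁿ_ : DecidableEquality (Fin ℓ ⊎ Fin ε)
  _≟ⁿ_ = Sum.≡-dec F._≟_ F._≟_

  module _ (bs : List Entry) where

    N : ℕ
    N = List.length bs

    entry : Fin N → Entry
    entry = List.lookup bs

    table : List (Fin N × Entry)
    table = List.tabulate λ i → i , entry i

    Flag : Set
    Flag = (Fin N × Entry) × (Fin 3 × Fin 3)

    coefs : Flag → Coef × Coef
    coefs ((_ , t) , x , y) = coef t x , coef t y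

    At : Fin ℓ → Fin ℓ → Flag → Set
    At a b ((_ , t) , x , y) = x ≢ y × lev t x ≡ a × lev t y ≡ b

    at? : ∀ a b f → Dec (At a b f)
    at? a b ((_ , t) , x , y) = ¬? (x F.≟ y) ×-dec ((lev t x F.≟ a) ×-dec (lev t y F.≟ b))

    _opp_ : Flag → Flag → Set
    f opp g = Opposite (coefs f) (coefs g)

    _opp?_ : ∀ f g → Dec (f opp g)
    f opp? g = ((c′ ≟ᶜ d) ×-dec (d′ ≟ᶜ c)) ⊎-dec ((c′ ≟ᶜ negate c) ×-dec (d′ ≟ᶜ negate d))
      where
      c = proj₁ (coefs f)
      d = proj₂ (coefs f)
      c′ = proj₁ (coefs g)
      d′ = proj₂ (coefs g)

    -- Of two opposite flags exactly one yields a block through given points with different ring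
    -- coordinates, so two opposite pairs yield exactly two blocks. The constructors record how the
    -- four flags are paired.
    data Balanced : List Flag → Set where
      12-34 : ∀ {f g h k} → f opp g → h opp k → Balanced (f ∷ g ∷ h ∷ k ∷ [])
      13-24 : ∀ {f g h k} → f opp h → g opp k → Balanced (f ∷ g ∷ h ∷ k ∷ [])
      14-23 : ∀ {f g h k} → f opp k → g opp h → Balanced (f ∷ g ∷ h ∷ k ∷ [])

    balanced? : ∀ l → Dec (Balanced l)
    balanced? (f ∷ g ∷ h ∷ k ∷ []) = map′
      (λ { (inj₁ (p , q)) → 12-34 p q ; (inj₂ (inj₁ (p , q))) → 13-24 p q ; (inj₂ (inj₂ (p , q))) → 14-23 p q })
      (λ { (12-34 p q) → inj₁ (p , q) ; (13-24 p q) → inj₂ (inj₁ (p , q)) ; (14-23 p q) → inj₂ (inj₂ (p , q)) })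
      (((f opp? g) ×-dec (h opp? k)) ⊎-dec (((f opp? h) ×-dec (g opp? k)) ⊎-dec ((f opp? k) ×-dec (g opp? h))))
    balanced? []                      = no λ ()
    balanced? (_ ∷ [])                = no λ ()
    balanced? (_ ∷ _ ∷ [])            = no λ ()
    balanced? (_ ∷ _ ∷ _ ∷ [])        = no λ ()
    balanced? (_ ∷ _ ∷ _ ∷ _ ∷ _ ∷ _) = no λ ()

    flags : List (Fin N × Entry) → List Flag
    flags tab = List.cartesianProduct tab (List.cartesianProduct (List.allFin 3) (List.allFin 3))

    -- Blocks with equal nests stay apart on a level when the coefficients are c and -c: a common
    -- point would mean c x = - c x′. Crossed pairs are excluded when the coefficients agree: s + c
    -- x + c x′ = s. Either equation gives x + x′ = 0, impossible in a half system.
    Compatible : (i j : Fin N) (t u : Entry) (x y : Fin 3) → Set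
    Compatible i j t u x y =
        (nestOf t ≢ nestOf u ⊎ lev t x ≢ lev u y ⊎ (i ≡ j × x ≡ y) ⊎ coef u y ≡ negate (coef t x))
      × (inj₁ (lev t x) ≢ nestOf u ⊎ nestOf t ≢ inj₁ (lev u y) ⊎ coef u y ≡ coef t x)

    compatible? : ∀ i j t u x y → Dec (Compatible i j t u x y)
    compatible? i j t u x y =
      (¬? (nestOf t ≟ⁿ nestOf u) ⊎-dec (¬? (lev t x F.≟ lev u y) ⊎-dec
        (((i F.≟ j) ×-dec (x F.≟ y)) ⊎-dec (coef u y ≟ᶜ negate (coef t x)))))
      ×-dec (¬? (inj₁ (lev t x) ≟ⁿ nestOf u) ⊎-dec (¬? (nestOf t ≟ⁿ inj₁ (lev u y)) ⊎-dec (coef u y ≟ᶜ coef t x)))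

    -- Only levels and formal coefficients occur, so a single evaluation serves every `HalvedRing`.
    Valid : List (Fin N × Entry) → Set
    Valid tab =
        All (λ (i , t) → ∀ x y → x ≡ y ⊎ coef t x ≢ coef t y) tab
      × (∀ a b → Balanced (List.filter (at? a b) (flags tab)))
      × All (λ (i , t) → All (λ (j , u) → ∀ x y → Compatible i j t u x y) tab) tab

    valid? : ∀ tab → Dec (Valid tab)
    valid? tab =
      All.all? (λ (i , t) → F.all? λ x → F.all? λ y → (x F.≟ y) ⊎-dec ¬? (coef t x ≟ᶜ coef t y)) tab
      ×-dec (balance? (flags tab)
      ×-dec All.all? (λ (i , t) → All.all? (λ (j , u) → F.all? λ x → F.all? λ y → compatible? i j t u x y) tab) tab)
      where
      balance? : ∀ fs → Dec (∀ a b → Balanced (List.filter (at? a b) fs))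
      balance? fs = F.all? λ a → F.all? λ b → balanced? (List.filter (at? a b) fs)

    module _ {q : ℕ} (H : HalvedRing q) (valid : Valid table) where
      open HalvedRing H using (r)
      open Lines H
      private
        Block : Set
        Block = Fin N × (Fin q × Fin r)

        pt : Block → Fin 3 → Fin q × Fin ℓ
        pt (i , s , k) x = val (coef (entry i) x) s k , lev (entry i) x

        place : Fin q → Fin ℓ ⊎ Fin ε → (Fin q × Fin ℓ) ⊎ (Fin q × Fin ε)
        place s = Sum⊎.map (s ,_) (s ,_)

        place-colour : ∀ s n → [ proj₁ , proj₁ ]′ (place s n) ≡ s
        place-colour s (inj₁ _) = refl
        place-colour s (inj₂ _) = refl

        place-injective : ∀ {s t m n} → place s m ≡ place t n → s ≡ t × m ≡ n
        place-injective {m = inj₁ _} {inj₁ _} refl = refl , refl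
        place-injective {m = inj₂ _} {inj₂ _} refl = refl , refl

        nest : Block → (Fin q × Fin ℓ) ⊎ (Fin q × Fin ε)
        nest (i , s , k) = place s (nestOf (entry i))

        ∈table : ∀ i → (i , entry i) ∈ˡ table
        ∈table i = ∈-tabulate⁺ i

        distinct-coefs : ∀ i {x y} → x ≢ y → coef (entry i) x ≢ coef (entry i) y
        distinct-coefs i {x} {y} x≢y with All.lookup (proj₁ valid) (∈table i) x y
        ... | inj₁ eq = ⊥-elim (x≢y eq)
        ... | inj₂ ne = ne

        compatible : ∀ i j x y → Compatible i j (entry i) (entry j) x y
        compatible i j = All.lookup (All.lookup (proj₂ (proj₂ valid)) (∈table i)) (∈table j)

        spread : ∀ b {x y} → x ≢ y → proj₁ (pt b x) ≢ proj₁ (pt b y)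
        spread (i , s , k) x≢y = val-spread (distinct-coefs i x≢y) s k

        spread⁻ : ∀ b {x y} → proj₁ (pt b x) ≡ proj₁ (pt b y) → x ≡ y
        spread⁻ b {x} {y} eq with x F.≟ y
        ... | yes x≡y = x≡y
        ... | no x≢y  = ⊥-elim (spread b x≢y eq)

        once : ∀ {b c x y} → pt b x ≡ pt c y → nest b ≡ nest c → b ≡ c
        once {i , s , k} {j , s′ , k′} {x} {y} e₁ e₂
          with place-injective {m = nestOf (entry i)} {nestOf (entry j)} e₂ | proj₁ (compatible i j x y)
        ... | refl , n | inj₁ ne                            = ⊥-elim (ne n)
        ... | refl , n | inj₂ (inj₁ ne)                     = ⊥-elim (ne (cong proj₂ e₁))
        ... | refl , n | inj₂ (inj₂ (inj₁ (refl , refl)))   =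
          cong (λ k → i , s , k) (val-injective (coef (entry i) x) s (cong proj₁ e₁))
        ... | refl , n | inj₂ (inj₂ (inj₂ e))               =
          ⊥-elim (val-negate (coef (entry i) x) s k k′ (trans (cong proj₁ e₁) (cong (λ c → val c s k′) e)))

        uncross : ∀ {b c x y} → inj₁ (pt b x) ≡ nest c → nest b ≡ inj₁ (pt c y) → ⊥
        uncross {i , s , k} {j , s′ , k′} {x} {y} e₁ e₂
          with place-injective {m = inj₁ (lev (entry i) x)} {nestOf (entry j)} e₁
             | place-injective {m = nestOf (entry i)} {inj₁ (lev (entry j) y)} e₂
             | proj₂ (compatible i j x y)
        ... | p , n | p′ , n′ | inj₁ ne        = ne n
        ... | p , n | p′ , n′ | inj₂ (inj₁ ne) = ne n′
        ... | p , n | p′ , n′ | inj₂ (inj₂ e)  =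
          val-cross (coef (entry i) x) k k′ p (trans (cong (λ c → val c s′ k′) (sym e)) (sym p′))

        module Cover (u v : Fin q) (a b : Fin ℓ) (u≢v : u ≢ v) where

          Through : Block → Set
          Through d = (u , a) ∈ᵇ pt d × (v , b) ∈ᵇ pt d

          joint : List Flag
          joint = List.filter (at? a b) (flags table)

          joint⁺ : ∀ {i x y} → At a b ((i , entry i) , x , y) → ((i , entry i) , x , y) ∈ˡ joint
          joint⁺ {i} {x} {y} h = ∈-filter⁺ (at? a b)
            (∈-cartesianProduct⁺ (∈table i) (∈-cartesianProduct⁺ (∈-allFin x) (∈-allFin y))) h

          joint⁻ : ∀ {i t x y} → ((i , t) , x , y) ∈ˡ joint → t ≡ entry i × At a b ((i , t) , x , y)
          joint⁻ m with ∈-filter⁻ (at? a b) {xs = flags table} m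
          ... | m′ , h with ∈-cartesianProduct⁻ table _ m′
          ...   | m″ , _ with ∈-tabulate⁻ {f = λ i → i , entry i} m″
          ...     | _ , refl = refl , h

          Solution : Flag → Fin q × Fin r → Set
          Solution f = Joins (proj₁ (coefs f)) (proj₂ (coefs f)) u v

          block : Flag → Fin q × Fin r → Block
          block ((i , _) , _) z = i , z

          through : ∀ {f z} → f ∈ˡ joint → Solution f z → Through (block f z)
          through {(i , t) , x , y} m (p , q) with joint⁻ m
          ... | refl , _ , lx , ly = (x , cong₂ _,_ p lx) , (y , cong₂ _,_ q ly)

          coefs-≢ : ∀ {f} → f ∈ˡ joint → proj₁ (coefs f) ≢ proj₂ (coefs f)
          coefs-≢ {(i , t) , x , y} m with joint⁻ m
          ... | refl , x≢y , _ = distinct-coefs i x≢y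

          -- The corners of a block have different ring coordinates, so `u` and `v` determine the
          -- two positions.
          same-flag : ∀ {f g y z} → f ∈ˡ joint → g ∈ˡ joint → Solution f y → Solution g z → block f y ≡ block g z → f ≡ g
          same-flag {(i , t) , x , y} {(_ , t′) , x′ , y′} m m′ (p , q) (p′ , q′) refl with joint⁻ m | joint⁻ m′
          ... | refl , _ | refl , _ with spread⁻ (block ((i , t) , x , y) _) {x} {x′} (trans p (sym p′))
                                       | spread⁻ (block ((i , t) , x , y) _) {y} {y′} (trans q (sym q′))
          ... | refl | refl = refl

          flag-of : ∀ d → Through d → ∃ λ f → f ∈ˡ joint × Solution f (proj₂ d) × block f (proj₂ d) ≡ d
          flag-of d@(i , z) ((x , e) , (y , e′)) = ((i , entry i) , x , y)
            , joint⁺ ((λ { refl → u≢v (trans (sym (cong proj₁ e)) (cong proj₁ e′)) }) , cong proj₂ e , cong proj₂ e′)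
            , (cong proj₁ e , cong proj₁ e′) , refl

          record Pick (f g : Flag) : Set where
            field
              flag     : Flag
              member   : flag ∈ˡ joint
              solution : Fin q × Fin r
              solves   : Solution flag solution
              from     : flag ≡ f ⊎ flag ≡ g
              only     : ∀ {z} → (Solution f z → block f z ≡ block flag solution)
                               × (Solution g z → block g z ≡ block flag solution)

          pick : ∀ {f g} → f ∈ˡ joint → g ∈ˡ joint → f opp g → Pick f g
          pick {f} {g} mf mg o with join-one o (coefs-≢ mf) u≢v
          ... | inj₁ (z , sol) = record
            { flag = f ; member = mf ; solution = z ; solves = sol ; from = inj₁ refl
            ; only = (λ s → cong (proj₁ (proj₁ f) ,_) (uncurry (cong₂ _,_)
                (val-unique (coefs-≢ mf) (trans (proj₁ s) (sym (proj₁ sol))) (trans (proj₂ s) (sym (proj₂ sol))))))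
              , (λ s → ⊥-elim (join-not-both o (coefs-≢ mf) sol s)) }
          ... | inj₂ (z , sol) = record
            { flag = g ; member = mg ; solution = z ; solves = sol ; from = inj₂ refl
            ; only = (λ s → ⊥-elim (join-not-both o (coefs-≢ mf) s sol))
              , (λ s → cong (proj₁ (proj₁ g) ,_) (uncurry (cong₂ _,_)
                (val-unique (coefs-≢ mg) (trans (proj₁ s) (sym (proj₁ sol))) (trans (proj₂ s) (sym (proj₂ sol)))))) }

          two-pairs : ∀ {f g h k} → (∀ {e} → e ∈ˡ joint → (e ≡ f ⊎ e ≡ g) ⊎ (e ≡ h ⊎ e ≡ k)) →
                      f ≢ h → f ≢ k → g ≢ h → g ≢ k → Pick f g → Pick h k → Twice Through
          two-pairs {f} {g} {h} {k} complete fh fk gh gk P Q =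
            block P.flag P.solution , block Q.flag Q.solution
            , (λ eq → apart P.from Q.from (same-flag P.member Q.member P.solves Q.solves eq))
            , through P.member P.solves , through Q.member Q.solves , only
            where
            module P = Pick P
            module Q = Pick Q

            apart : ∀ {d e} → d ≡ f ⊎ d ≡ g → e ≡ h ⊎ e ≡ k → d ≢ e
            apart (inj₁ refl) (inj₁ refl) = fh
            apart (inj₁ refl) (inj₂ refl) = fk
            apart (inj₂ refl) (inj₁ refl) = gh
            apart (inj₂ refl) (inj₂ refl) = gk

            only : ∀ d → Through d → d ≡ block P.flag P.solution ⊎ d ≡ block Q.flag Q.solution
            only d thr with flag-of d thr
            ... | e , m , sol , refl with complete m
            ... | inj₁ (inj₁ refl) = inj₁ (proj₁ P.only sol)
            ... | inj₁ (inj₂ refl) = inj₁ (proj₂ P.only sol)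
            ... | inj₂ (inj₁ refl) = inj₂ (proj₁ Q.only sol)
            ... | inj₂ (inj₂ refl) = inj₂ (proj₂ Q.only sol)

          joint-unique : Unique joint
          joint-unique = Unique.filter⁺ (at? a b) (Unique.cartesianProduct⁺ (Unique.tabulate⁺ (cong proj₁))
            (Unique.cartesianProduct⁺ (Unique.allFin⁺ 3) (Unique.allFin⁺ 3)))

          module _ {f g h k} (eq : f ∷ g ∷ h ∷ k ∷ [] ≡ joint) where
            into : ∀ {e} → e ∈ˡ f ∷ g ∷ h ∷ k ∷ [] → e ∈ˡ joint
            into {e} = subst (e ∈ˡ_) eq

            mf : f ∈ˡ joint
            mf = into (here refl)
            mg : g ∈ˡ joint
            mg = into (there (here refl))
            mh : h ∈ˡ joint
            mh = into (there (there (here refl)))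
            mk : k ∈ˡ joint
            mk = into (there (there (there (here refl))))

            cases : (R : Flag → Set) → R f → R g → R h → R k → ∀ {e} → e ∈ˡ joint → R e
            cases R rf rg rh rk {e} m with subst (e ∈ˡ_) (sym eq) m
            ... | here refl                         = rf
            ... | there (here refl)                 = rg
            ... | there (there (here refl))         = rh
            ... | there (there (there (here refl))) = rk

          twice : ∀ l → l ≡ joint → Unique l → Balanced l → Twice Through
          twice (f ∷ g ∷ h ∷ k ∷ []) eq ((fg All.∷ fh All.∷ fk All.∷ _) ∷ (gh All.∷ gk All.∷ _) ∷ (hk All.∷ _) ∷ _) (12-34 p q) =
            two-pairs (cases eq (λ e → (e ≡ f ⊎ e ≡ g) ⊎ (e ≡ h ⊎ e ≡ k))
              (inj₁ (inj₁ refl)) (inj₁ (inj₂ refl)) (inj₂ (inj₁ refl)) (inj₂ (inj₂ refl)))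
              fh fk gh gk (pick (mf eq) (mg eq) p) (pick (mh eq) (mk eq) q)
          twice (f ∷ g ∷ h ∷ k ∷ []) eq ((fg All.∷ fh All.∷ fk All.∷ _) ∷ (gh All.∷ gk All.∷ _) ∷ (hk All.∷ _) ∷ _) (13-24 p q) =
            two-pairs (cases eq (λ e → (e ≡ f ⊎ e ≡ h) ⊎ (e ≡ g ⊎ e ≡ k))
              (inj₁ (inj₁ refl)) (inj₂ (inj₁ refl)) (inj₁ (inj₂ refl)) (inj₂ (inj₂ refl)))
              fg fk (gh ∘ sym) hk (pick (mf eq) (mh eq) p) (pick (mg eq) (mk eq) q)
          twice (f ∷ g ∷ h ∷ k ∷ []) eq ((fg All.∷ fh All.∷ fk All.∷ _) ∷ (gh All.∷ gk All.∷ _) ∷ (hk All.∷ _) ∷ _) (14-23 p q) =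
            two-pairs (cases eq (λ e → (e ≡ f ⊎ e ≡ k) ⊎ (e ≡ g ⊎ e ≡ h))
              (inj₁ (inj₁ refl)) (inj₂ (inj₁ refl)) (inj₂ (inj₂ refl)) (inj₁ (inj₂ refl)))
              fg fh (gk ∘ sym) (hk ∘ sym) (pick (mf eq) (mk eq) p) (pick (mg eq) (mh eq) q)

      linearFrame : Frame (Fin q) (Fin ℓ) (Fin ε)
      linearFrame = record
        { Block   = Block
        ; size    = N * (q * r)
        ; enum    = (↔-id _ ×-↔ F.*↔×) ↔-∘ F.*↔×
        ; pt      = pt
        ; nest    = nest
        ; spread  = spread
        ; avoid   = λ (i , s , k) x eq → val≢base (coef (entry i) x) s k
                      (sym (trans (sym (place-colour s (nestOf (entry i)))) eq))
        ; cover   = λ (u , a) (v , b) u≢v → let open Cover u v a b u≢v in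
                      twice joint refl joint-unique (proj₁ (proj₂ valid) a b)
        ; once    = λ {b} {c} {x} {y} → once {b} {c} {x} {y}
        ; uncross = λ {b} {c} {x} {y} → uncross {b} {c} {x} {y}
        }

shiftEntries : ∀ {ℓ d} → (ℕ → Fin ℓ) → (ℕ → Fin d) → List ℕ →
               List ((ℕ × Coef) × (ℕ × Coef) × (ℕ × Coef) × (ℕ ⊎ ℕ)) → List (Linear.Entry ℓ d)
shiftEntries lev cls shifts bs = List.cartesianProductWith shift shifts bs
  where
  shift : ℕ → _ → _
  shift i ((a , c) , (a′ , c′) , (a″ , c″) , n) =
    (lev (a + i) , c) , (lev (a′ + i) , c′) , (lev (a″ + i) , c″) , Sum⊎.map (λ l → lev (l + i)) (λ e → cls (e + i)) n

linear-12 : ∀ {q} → HalvedRing q → Frame (Fin q) (Fin 12) (Fin 6)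
linear-12 H = linearFrame entries H (from-yes (valid? entries (table entries)))
  where
  open Linear 12 6
  entries : List Entry
  entries = shiftEntries (_mod 12) (_mod 6) (List.upTo 12)
    ( ((8 , -βc) , (11 , +βc) , (7 , +1c) , inj₂ 0)
    ∷ ((2 , +βc) , (5 , -βc) , (7 , -1c) , inj₂ 0)
    ∷ ((4 , +βc) , (6 , +1c) , (0 , -1c) , inj₂ 0)
    ∷ ((4 , -βc) , (3 , -1c) , (9 , +1c) , inj₂ 0)
    ∷ ((11 , +1c) , (2 , -βc) , (9 , -1c) , inj₁ 0)
    ∷ ((11 , -1c) , (2 , +βc) , (9 , +1c) , inj₁ 0)
    ∷ ((6 , +βc) , (5 , -1c) , (5 , +1c) , inj₁ 0)
    ∷ ((8 , -1c) , (0 , -βc) , (8 , +1c) , inj₁ 0)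
    ∷ [])

-- Level 2 i + j is point j of the i-th of three pairs, which are permuted along with the classes.
linear-6 : ∀ {q} → HalvedRing q → Frame (Fin q) (Fin 6) (Fin 3)
linear-6 H = linearFrame entries H (from-yes (valid? entries (table entries)))
  where
  open Linear 6 3
  entries : List Entry
  entries = shiftEntries (_mod 6) (λ e → (e / 2) mod 3) (0 ∷ 2 ∷ 4 ∷ [])
    ( ((3 , -βc) , (1 , +1c) , (0 , -1c) , inj₂ 0)
    ∷ ((1 , -1c) , (0 , +1c) , (4 , -βc) , inj₂ 0)
    ∷ ((5 , +1c) , (3 , +βc) , (2 , -1c) , inj₂ 0)
    ∷ ((2 , +1c) , (4 , +βc) , (5 , -1c) , inj₂ 0)
    ∷ ((3 , +1c) , (1 , -βc) , (3 , -1c) , inj₁ 1)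
    ∷ ((5 , +1c) , (0 , +βc) , (5 , -1c) , inj₁ 0)
    ∷ ((0 , +1c) , (0 , -1c) , (4 , +βc) , inj₁ 1)
    ∷ ((4 , -1c) , (4 , +1c) , (3 , +βc) , inj₁ 0)
    ∷ [])

-- Half systems: the integers modulo an odd number, and the field of nine elements.

module _ (k : ℕ) where
  open Modular (k + k) public using () renaming (isCommutativeRing to oddRing)
  private
    m : ℕ
    m = suc (k + k)
    open Modular (k + k)
    open FinRing oddRing using (Unit)

  modular-unit : ∀ a {u j} → u * a ≡ 1 + j * m → Unit (e a)
  modular-unit a {u} {j} eq = e u , trans (e-* u a) (trans (cong e eq) (e-periodic j 1))

  modular-𝟚-unit : Unit (e 2)
  modular-𝟚-unit = modular-unit 2 {suc k} {1} (lemma k)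
    where
    lemma : ∀ k → suc k * 2 ≡ 1 + 1 * suc (k + k)
    lemma = solve-∀

  -- With β = 2 the elements β - 1, β, β + 1 are 1, 2, 3; the half system is 1, ..., k. The case k =
  -- 0 is the zero ring with an empty half system.
  modularHalved : (u j : ℕ) → u * 3 ≡ 1 + j * suc (k + k) → HalvedRing (suc (k + k))
  modularHalved u j inverse-of-3 = record
    { isCommutativeRing = oddRing
    ; β = e 2 ; γ = e 1 ; 𝟙⊕γ = e-+ 1 1
    ; 𝟚-unit = subst Unit (sym (e-+ 1 1)) modular-𝟚-unit
    ; β-unit = modular-𝟚-unit
    ; γ-unit = modular-unit 1 {1} {0} refl
    ; β+1-unit = subst Unit (sym (e-+ 2 1)) (modular-unit 3 {u} {j} inverse-of-3)
    ; r = k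
    ; ρ = λ i → e (suc (toℕ i))
    ; halves = halves
    ; disjoint = λ i j eq → ℕ.1+n≢0 (trans (sym (small (s≤s (bound i j))))
        (cong toℕ (trans (sym (e-+ (suc (toℕ i)) (suc (toℕ j)))) eq)))
    ; ρ-injective = λ {i} {j} eq → F.toℕ-injective (ℕ.suc-injective
        (trans (sym (small (small< i))) (trans (cong toℕ eq) (small (small< j)))))
    }
    where
    small : ∀ {a} → a < m → toℕ (e a) ≡ a
    small {a} a<m = trans (toℕ-e a) (DivMod.m<n⇒m%n≡m a<m)

    bound : ∀ i j → suc (toℕ i) + suc (toℕ {k} j) ≤ k + k
    bound i j = ℕ.+-mono-≤ (F.toℕ<n i) (F.toℕ<n j)

    small< : ∀ (i : Fin k) → suc (toℕ i) < m
    small< i = s≤s (ℕ.≤-trans (F.toℕ<n i) (ℕ.m≤m+n k k))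

    halves : ∀ x → x ≢ e 0 → ∃ λ i → x ≡ e (suc (toℕ i)) ⊎ x ⊕ e (suc (toℕ i)) ≡ e 0
    halves zero    x≢0 = ⊥-elim (x≢0 (F.toℕ-injective (sym (toℕ-e 0))))
    halves (suc y) x≢0 with toℕ y ℕ.<? k
    ... | yes y<k = F.fromℕ< y<k , inj₁ (trans (sym (e-toℕ (suc y))) (cong (λ n → e (suc n)) (sym (F.toℕ-fromℕ< y<k))))
    ... | no y≮k  = F.fromℕ< n<k , inj₂ (begin
        suc y ⊕ e (suc (toℕ (F.fromℕ< n<k)))  ≡⟨ cong₂ _⊕_ (sym (e-toℕ (suc y))) (cong (λ n → e (suc n)) (F.toℕ-fromℕ< n<k)) ⟩
        e (suc (toℕ y)) ⊕ e (suc n)           ≡⟨ e-+ (suc (toℕ y)) (suc n) ⟩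
        e (suc (toℕ y) + suc n)               ≡⟨ cong e total ⟩
        e (0 + 1 * m)                         ≡⟨ e-periodic 1 0 ⟩
        e 0                                   ∎)
      where
      open ≡-Reasoning
      -- For x = `suc y` beyond k, the representative of -x is m - x = n + 1.
      n : ℕ
      n = k + k ∸ suc (toℕ y)
      y<2k : suc (toℕ y) ≤ k + k
      y<2k = F.toℕ<n y
      total : suc (toℕ y) + suc n ≡ 0 + 1 * m
      total = trans (ℕ.+-suc (suc (toℕ y)) n) (trans (cong suc (ℕ.m+[n∸m]≡n y<2k)) (sym (ℕ.+-identityʳ m)))
      n<k : n < k
      n<k = ℕ.+-cancelˡ-≤ (suc (toℕ y)) _ _ (ℕ.≤-trans (ℕ.≤-reflexive (trans (ℕ.+-suc (suc (toℕ y)) n)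
              (cong suc (ℕ.m+[n∸m]≡n y<2k)))) (s≤s (ℕ.+-monoˡ-≤ k (ℕ.≮⇒≥ y≮k))))

-- a + b i over the integers modulo 3 is encoded as 3 a + b.
F₉ : HalvedRing 9
F₉ = record
  -- `# 6` encodes 2 = -1.
  { _⊕_ = _⊕_ ; _⊗_ = _⊗_ ; ⊖_ = λ x → (# 6) ⊗ x ; 𝟘 = # 0 ; 𝟙 = # 3
  ; isCommutativeRing = record
    { isRing = record
      { +-isAbelianGroup = record
        { isGroup = record
          { isMonoid = record
            { isSemigroup = record
              { isMagma = record { isEquivalence = isEquivalence ; ∙-cong = cong₂ _⊕_ }
              ; assoc = from-yes (F.all? λ x → F.all? λ y → F.all? λ z → ((x ⊕ y) ⊕ z) F.≟ (x ⊕ (y ⊕ z))) }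
            ; identity = from-yes (F.all? λ x → ((# 0) ⊕ x) F.≟ x) , from-yes (F.all? λ x → (x ⊕ (# 0)) F.≟ x) }
          ; inverse = from-yes (F.all? λ x → (((# 6) ⊗ x) ⊕ x) F.≟ (# 0)) , from-yes (F.all? λ x → (x ⊕ ((# 6) ⊗ x)) F.≟ (# 0))
          ; ⁻¹-cong = cong ((# 6) ⊗_) }
        ; comm = from-yes (F.all? λ x → F.all? λ y → (x ⊕ y) F.≟ (y ⊕ x)) }
      ; *-cong = cong₂ _⊗_
      ; *-assoc = from-yes (F.all? λ x → F.all? λ y → F.all? λ z → ((x ⊗ y) ⊗ z) F.≟ (x ⊗ (y ⊗ z)))
      ; *-identity = from-yes (F.all? λ x → ((# 3) ⊗ x) F.≟ x) , from-yes (F.all? λ x → (x ⊗ (# 3)) F.≟ x)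
      ; distrib = from-yes (F.all? λ x → F.all? λ y → F.all? λ z → (x ⊗ (y ⊕ z)) F.≟ ((x ⊗ y) ⊕ (x ⊗ z)))
                , from-yes (F.all? λ x → F.all? λ y → F.all? λ z → ((y ⊕ z) ⊗ x) F.≟ ((y ⊗ x) ⊕ (z ⊗ x))) }
    ; *-comm = from-yes (F.all? λ x → F.all? λ y → (x ⊗ y) F.≟ (y ⊗ x)) }
  -- β = i, so that β - 1, β and β + 1 are all nonzero.
  ; β = # 1 ; γ = # 7 ; 𝟙⊕γ = refl
  ; 𝟚-unit = # 6 , refl ; β-unit = # 2 , refl ; γ-unit = # 4 , refl ; β+1-unit = # 7 , refl
  ; r = 4
  ; ρ = ρ
  ; halves = from-yes (F.all? λ x → ¬? (x F.≟ (# 0)) →-dec F.any? λ k → (x F.≟ ρ k) ⊎-dec ((x ⊕ ρ k) F.≟ (# 0)))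
  ; disjoint = from-yes (F.all? λ k → F.all? λ l → ¬? ((ρ k ⊕ ρ l) F.≟ (# 0)))
  ; ρ-injective = λ {k} {l} → from-yes (F.all? λ k → F.all? λ l → (ρ k F.≟ ρ l) →-dec (k F.≟ l)) k l
  }
  where
  _⊕_ _⊗_ : Fin 9 → Fin 9 → Fin 9
  x ⊕ y = (3 * ((toℕ x / 3 + toℕ y / 3) % 3) + (toℕ x + toℕ y) % 3) mod 9
  x ⊗ y = (3 * ((a * c + 2 * b * d) % 3) + (a * d + b * c) % 3) mod 9
    where
    a = toℕ x / 3
    b = toℕ x % 3
    c = toℕ y / 3
    d = toℕ y % 3
  ρ : Fin 4 → Fin 9
  ρ = lookup (# 1 ∷ # 3 ∷ # 4 ∷ # 5 ∷ [])

-- Orthogonal arrays with four columns.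

module _ {m : ℕ} {_⊕_ _⊗_ : Fin m → Fin m → Fin m} {⊖_ : Fin m → Fin m} {𝟘 𝟙 : Fin m}
         (isCommutativeRing : IsCommutativeRing _≡_ _⊕_ _⊗_ ⊖_ 𝟘 𝟙)
         (𝟚-unit : FinRing.Unit isCommutativeRing (𝟙 ⊕ 𝟙)) where
  open FinRing isCommutativeRing
  private
    slope : Fin 3 → Fin m
    slope zero             = 𝟘
    slope (suc zero)       = 𝟙
    slope (suc (suc zero)) = 𝟙 ⊕ 𝟙

    -- The forms x, s, s + x and s + 2 x. Any two of them are independent because the slopes 0, 1, 2
    -- differ by units.
    column : Fin 4 → Fin m × Fin m → Fin m
    column zero    (s , x) = x
    column (suc i) (s , x) = s ⊕ (slope i ⊗ x)

    Gap : Fin 3 → Fin 3 → Set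
    Gap i j = ∃ λ δ → slope i ⊕ δ ≡ slope j × Unit δ

    reverse : ∀ {i j} → Gap i j → Gap j i
    reverse {i} (δ , eq , u) = ⊖ δ , trans (cong (_⊕ (⊖ δ)) (sym eq)) (G.//-rightDividesʳ δ (slope i)) , ⊖-unit u

    0-1 : Gap zero (suc zero)
    0-1 = 𝟙 , R.+-identityˡ 𝟙 , 𝟙-unit
    0-2 : Gap zero (suc (suc zero))
    0-2 = 𝟙 ⊕ 𝟙 , R.+-identityˡ (𝟙 ⊕ 𝟙) , 𝟚-unit
    1-2 : Gap (suc zero) (suc (suc zero))
    1-2 = 𝟙 , refl , 𝟙-unit

    gap : ∀ i j → i ≢ j → Gap i j
    gap zero             (suc zero)       _ = 0-1
    gap zero             (suc (suc zero)) _ = 0-2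
    gap (suc zero)       (suc (suc zero)) _ = 1-2
    gap (suc zero)       zero             _ = reverse {zero} {suc zero} 0-1
    gap (suc (suc zero)) zero             _ = reverse {zero} {suc (suc zero)} 0-2
    gap (suc (suc zero)) (suc zero)       _ = reverse {suc zero} {suc (suc zero)} 1-2
    gap zero             zero             i≢j = ⊥-elim (i≢j refl)
    gap (suc zero)       (suc zero)       i≢j = ⊥-elim (i≢j refl)
    gap (suc (suc zero)) (suc (suc zero)) i≢j = ⊥-elim (i≢j refl)

    gap-shift : ∀ {i j} (g : Gap i j) s x → column (suc i) (s , x) ⊕ (proj₁ g ⊗ x) ≡ column (suc j) (s , x)
    gap-shift {i} (δ , eq , _) s x = trans (R.+-assoc s _ _)
      (cong (s ⊕_) (trans (sym (R.distribʳ x (slope i) δ)) (cong (_⊗ x) eq)))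

    solve : ∀ i j → i ≢ j → ∀ u v → Σ (Fin m × Fin m) λ r → column i r ≡ u × column j r ≡ v
    solve zero    zero    i≢j u v = ⊥-elim (i≢j refl)
    solve zero    (suc j) _   u v = (v ⊕ (⊖ (slope j ⊗ u)) , u) , refl , G.//-rightDividesˡ _ v
    solve (suc i) zero    _   u v = (u ⊕ (⊖ (slope i ⊗ v)) , v) , G.//-rightDividesˡ _ u , refl
    solve (suc i) (suc j) i≢j u v with gap i j (i≢j ∘ cong suc)
    ... | g@(δ , _ , unit) with unit-divide unit ((⊖ u) ⊕ v)
    ...   | x , δx = (s , x) , at-i , trans (sym (gap-shift {i} {j} g s x))
              (trans (cong₂ _⊕_ at-i δx) (G.\\-leftDividesˡ u v))
      where
      s : Fin m
      s = u ⊕ (⊖ (slope i ⊗ x))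
      at-i : column (suc i) (s , x) ≡ u
      at-i = G.//-rightDividesˡ _ u

    unique : ∀ i j → i ≢ j → ∀ {r r′} → column i r ≡ column i r′ → column j r ≡ column j r′ → r ≡ r′
    unique zero    zero    i≢j _ _ = ⊥-elim (i≢j refl)
    unique zero    (suc j) _ refl e = cong (λ s → s , _) (G.∙-cancelʳ _ _ _ e)
    unique (suc i) zero    _ e refl = cong (λ s → s , _) (G.∙-cancelʳ _ _ _ e)
    unique (suc i) (suc j) i≢j {s , x} {s′ , x′} e₁ e₂ with gap i j (i≢j ∘ cong suc)
    ... | g@(δ , _ , unit) with unit-cancel unit (G.∙-cancelˡ (column (suc i) (s , x)) _ _
            (trans (gap-shift {i} {j} g s x) (trans e₂ (trans (sym (gap-shift {i} {j} g s′ x′)) (cong (_⊕ (δ ⊗ x′)) (sym e₁))))))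
    ...   | refl = cong (λ s → s , x) (G.∙-cancelʳ _ _ _ e₁)

  ringOA : OA (Fin m)
  ringOA = record { col = column ; solve = λ {i} {j} → solve i j ; unique = λ {i} {j} → unique i j }

oddOA : ∀ k → OA (Fin (suc (k + k)))
oddOA k = ringOA (oddRing k) (subst (FinRing.Unit (oddRing k)) (sym (Modular.e-+ (k + k) 1 1)) (modular-𝟚-unit k))

-- The columns a, b, a + b, a + ω b over the field of four elements 0, 1, ω, ω + 1.
oa₄ : OA (Fin 4)
oa₄ = record
  { col = col
  ; solve = λ {i} {j} i≢j u v → solve {i} {j} (check i j i≢j u v)
  ; unique = λ {i} {j} i≢j {r} {s} p q → unique {i} {j} {r} {s} (check i j i≢j (col i s) (col j s)) p q
  }
  where
  add : Fin 4 → Fin 4 → Fin 4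
  add a b = lookup (lookup ((# 0 ∷ # 1 ∷ # 2 ∷ # 3 ∷ []) ∷ (# 1 ∷ # 0 ∷ # 3 ∷ # 2 ∷ []) ∷
                            (# 2 ∷ # 3 ∷ # 0 ∷ # 1 ∷ []) ∷ (# 3 ∷ # 2 ∷ # 1 ∷ # 0 ∷ []) ∷ []) a) b

  col : Fin 4 → Fin 4 × Fin 4 → Fin 4
  col zero                   (a , b) = a
  col (suc zero)             (a , b) = b
  col (suc (suc zero))       (a , b) = add a b
  col (suc (suc (suc zero))) (a , b) = add a (lookup (# 0 ∷ # 2 ∷ # 3 ∷ # 1 ∷ []) b)

  Single : ∀ i j (u v : Fin 4) → Set
  Single i j u v = ∃ λ a → ∃ λ b → col i (a , b) ≡ u × col j (a , b) ≡ v ×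
    (∀ a′ b′ → col i (a′ , b′) ≡ u → col j (a′ , b′) ≡ v → (a′ , b′) ≡ (a , b))

  solve : ∀ {i j u v} → Single i j u v → Σ (Fin 4 × Fin 4) λ r → col i r ≡ u × col j r ≡ v
  solve (a , b , p , q , _) = (a , b) , p , q

  unique : ∀ {i j r s} → Single i j (col i s) (col j s) → col i r ≡ col i s → col j r ≡ col j s → r ≡ s
  unique (_ , _ , _ , _ , only) p q = trans (only _ _ p q) (sym (only _ _ refl refl))

  check : ∀ i j → i ≢ j → ∀ u v → Single i j u v
  check = from-yes (F.all? λ i → F.all? λ j → ¬? (i F.≟ j) →-dec (F.all? λ u → F.all? λ v → F.any? λ a → F.any? λ b →
    (col i (a , b) F.≟ u) ×-dec ((col j (a , b) F.≟ v) ×-dec (F.all? λ a′ → F.all? λ b′ →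
      (col i (a′ , b′) F.≟ u) →-dec ((col j (a′ , b′) F.≟ v) →-dec Prod.≡-dec F._≟_ F._≟_ (a′ , b′) (a , b))))))

-- MacNeish's product: the columns act separately on the two coordinates of `Fin (m * n)`, and a row
-- is a pair of rows of the factors.
_⊠_ : ∀ {m n} → OA (Fin m) → OA (Fin n) → OA (Fin (m * n))
_⊠_ {m} {n} A B = record
  { col    = λ i (x , y) → combine (A.col i (hi x , hi y)) (B.col i (lo x , lo y))
  ; solve  = λ {i} {j} i≢j u v →
      let ((a , a′) , p , q) = A.solve i≢j (hi u) (hi v)
          ((b , b′) , p′ , q′) = B.solve i≢j (lo u) (lo v)
      in (combine a b , combine a′ b′) , glue i a b a′ b′ p p′ , glue j a b a′ b′ q q′
  ; unique = λ {i} {j} i≢j {(x , y)} {(x′ , y′)} e₁ e₂ →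
      let (p , p′) = F.combine-injective _ _ _ _ e₁
          (q , q′) = F.combine-injective _ _ _ _ e₂
          e = A.unique i≢j p q
          e′ = B.unique i≢j p′ q′
      in cong₂ _,_ (parts (cong proj₁ e) (cong proj₁ e′)) (parts (cong proj₂ e) (cong proj₂ e′))
  }
  where
  module A = OA A
  module B = OA B
  combine : Fin m → Fin n → Fin (m * n)
  combine = F.combine

  hi : Fin (m * n) → Fin m
  hi = proj₁ ∘ F.remQuot {m} n
  lo : Fin (m * n) → Fin n
  lo = proj₂ ∘ F.remQuot {m} n

  parts : ∀ {x y} → hi x ≡ hi y → lo x ≡ lo y → x ≡ y
  parts {x} {y} e e′ = trans (sym (F.combine-remQuot {m} n x)) (trans (cong₂ combine e e′) (F.combine-remQuot {m} n y))

  glue : ∀ i a b a′ b′ {u} → A.col i (a , a′) ≡ hi u → B.col i (b , b′) ≡ lo u →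
         combine (A.col i (hi (combine a b) , hi (combine a′ b′))) (B.col i (lo (combine a b) , lo (combine a′ b′))) ≡ u
  glue i a b a′ b′ {u} e e′ = trans
    (cong₂ combine
      (trans (cong₂ (λ x y → A.col i (x , y)) (cong proj₁ (F.remQuot-combine a b)) (cong proj₁ (F.remQuot-combine a′ b′))) e)
      (trans (cong₂ (λ x y → B.col i (x , y)) (cong proj₂ (F.remQuot-combine a b)) (cong proj₂ (F.remQuot-combine a′ b′))) e′))
    (F.combine-remQuot {m} n u)

-- The recursion on t.

data Mod₄ : ℕ → Set where
  4×_   : ∀ j → Mod₄ (4 * j)
  odd   : ∀ k → Mod₄ (suc (k + k))
  2×odd : ∀ k → Mod₄ (2 * suc (k + k))

mod₄ : ∀ n → Mod₄ n
mod₄ 0 = 4× 0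
mod₄ 1 = odd 0
mod₄ 2 = 2×odd 0
mod₄ 3 = odd 1
mod₄ (suc (suc (suc (suc n)))) with mod₄ n
... | 4× j    = subst Mod₄ (lemma j) (4× suc j)
  where
  lemma : ∀ j → 4 * suc j ≡ 4 + 4 * j
  lemma = solve-∀
... | odd k   = subst Mod₄ (lemma k) (odd (suc (suc k)))
  where
  lemma : ∀ k → suc (suc (suc k) + suc (suc k)) ≡ 4 + suc (k + k)
  lemma = solve-∀
... | 2×odd k = subst Mod₄ (lemma k) (2×odd (suc k))
  where
  lemma : ∀ k → 2 * suc (suc k + suc k) ≡ 4 + 2 * suc (k + k)
  lemma = solve-∀

data OddMod₃ : ℕ → Set where
  3×odd : ∀ k → OddMod₃ (3 * suc (k + k))
  coprime : ∀ k {u j} → u * 3 ≡ 1 + j * suc (k + k) → OddMod₃ (suc (k + k))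

oddMod₃ : ∀ k → OddMod₃ (suc (k + k))
-- Modulo 1 the number 3 is a unit; multiplication by 1 goes through the zero ring.
oddMod₃ 0 = coprime 0 {1} {2} refl
oddMod₃ 1 = 3×odd 0
oddMod₃ 2 = coprime 2 {2} {1} refl
oddMod₃ (suc (suc (suc k))) = subst OddMod₃ (lemma k) (shift (oddMod₃ k))
  where
  lemma : ∀ k → 6 + suc (k + k) ≡ suc (suc (suc (suc k)) + suc (suc (suc k)))
  lemma = solve-∀
  shift : ∀ {n} → OddMod₃ n → OddMod₃ (6 + n)
  shift (3×odd k) = subst OddMod₃ (eq k) (3×odd (suc k))
    where
    eq : ∀ k → 3 * suc (suc k + suc k) ≡ 6 + 3 * suc (k + k)
    eq = solve-∀
  -- From 3 u = 1 + j m follows 3 (u + 2 j) = 1 + j (m + 6).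
  shift (coprime k {u} {j} inv) = subst OddMod₃ (lemma′ k) (coprime (3 + k) {u + 2 * j} {j} (begin
      (u + 2 * j) * 3              ≡⟨ eq₁ u j ⟩
      u * 3 + 6 * j                ≡⟨ cong (_+ 6 * j) inv ⟩
      1 + j * suc (k + k) + 6 * j  ≡⟨ eq₂ j k ⟩
      1 + j * suc ((3 + k) + (3 + k)) ∎))
    where
    open ≡-Reasoning
    lemma′ : ∀ k → suc ((3 + k) + (3 + k)) ≡ 6 + suc (k + k)
    lemma′ = solve-∀
    eq₁ : ∀ u j → (u + 2 * j) * 3 ≡ u * 3 + 6 * j
    eq₁ = solve-∀
    eq₂ : ∀ j k → 1 + j * suc (k + k) + 6 * j ≡ 1 + j * suc ((3 + k) + (3 + k))
    eq₂ = solve-∀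

private
  k<m*k : ∀ m k → suc k < suc (suc m) * suc k
  k<m*k m k = subst (suc k <_) (ℕ.*-comm (suc k) (suc (suc m))) (ℕ.m<m*n (suc k) (suc (suc m)) (s≤s (s≤s z≤n)))

-- There is no orthogonal array with four columns for n = 2; the exponent of 2 in n is even here.
arrays : ∀ n → 1 ≤ n → (OA (Fin n) × OA (Fin (3 * n))) ⊎ OA (Fin (2 * n))
arrays n = go n (<-wellFounded n)
  where
  subst-OA : ∀ {a b} → a ≡ b → OA (Fin a) → OA (Fin b)
  subst-OA = subst (OA ∘ Fin)

  go : ∀ n → Acc _<_ n → 1 ≤ n → (OA (Fin n) × OA (Fin (3 * n))) ⊎ OA (Fin (2 * n))
  go n (acc rec) 1≤n with mod₄ n
  ... | odd k   = inj₁ (oddOA k , subst-OA (lemma k) (oddOA (1 + 3 * k)))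
    where
    lemma : ∀ k → suc ((1 + 3 * k) + (1 + 3 * k)) ≡ 3 * suc (k + k)
    lemma = solve-∀
  ... | 2×odd k = inj₂ (subst-OA (lemma k) (oa₄ ⊠ oddOA k))
    where
    lemma : ∀ k → 4 * suc (k + k) ≡ 2 * (2 * suc (k + k))
    lemma = solve-∀
  go _ (acc rec) () | 4× zero
  ... | 4× j@(suc i) with go j (rec (k<m*k 2 i)) (s≤s z≤n)
  ...   | inj₁ (A , B) = inj₁ (oa₄ ⊠ A , subst-OA (lemma j) (oa₄ ⊠ B))
    where
    lemma : ∀ j → 4 * (3 * j) ≡ 3 * (4 * j)
    lemma = solve-∀
  ...   | inj₂ A       = inj₂ (subst-OA (lemma j) (oa₄ ⊠ A))
    where
    lemma : ∀ j → 4 * (2 * j) ≡ 2 * (4 * j)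
    lemma = solve-∀

T : ℕ → Set₁
T t = U (2 * t)

private
  out : ∀ m t → m * (2 * t) ≡ 2 * (m * t)
  out = solve-∀

-- Groups of 12 t points arise from 12 with weight t or from 6 with weight 2 t, whichever array
-- exists.
T-× : ∀ {q} → HalvedRing q → ∀ {t} → 1 ≤ t → T t → T (q * t)
T-× {q} H {t} 1≤t D with arrays t 1≤t
... | inj₁ (A , _) = subst U (out q t) (expand {k = 6} {u = 2 * t} (linear-12 H) A (lemma t) D)
  where
  lemma : ∀ t → 6 * t ≡ 3 * (2 * t)
  lemma = solve-∀
... | inj₂ A       = subst U (out q t) (expand {k = 3} {u = 2 * t} (linear-6 H) A refl D)

-- The same choice between 4 with weight 3 t and 6 with weight 2 t. The case of 4 needs its own
-- frames, since the rings behind `T-×` have odd order.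
T-4× : ∀ {t} → 1 ≤ t → T t → T (4 * t)
T-4× {t} 1≤t D with arrays t 1≤t
... | inj₁ (_ , A) = subst U (out 4 t) (expand {k = 2} {u = 2 * t} frame-4⁴ A (lemma t) D)
  where
  lemma : ∀ t → 2 * (3 * t) ≡ 3 * (2 * t)
  lemma = solve-∀
... | inj₂ A       = subst U (out 4 t) (expand {k = 3} {u = 2 * t} frame-6⁴ A refl D)

-- Weight 3 makes the groups of a frame of type 6⁴ into four groups of 18 points, 72 in all.
t₆ : T 6
t₆ = expand {k = 3} {u = 3} frame-6⁴ (oddOA 1) refl u₃

strongDesign : ∀ t → 1 ≤ t → T t
strongDesign t = go t (<-wellFounded t)
  where
  -- If n is coprime to 3, the ring modulo n multiplies `T d`. If n is 3 times such a number, the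
  -- factor 3 stays in the base design `T (3 * d)`. A factor 9 is taken off by `F₉`; the last
  -- argument provides the recursive call on the smaller number.
  times : ∀ d {n} → 1 ≤ d → OddMod₃ n → T d → T (3 * d) → (∀ k → n ≡ 9 * suc (k + k) → T (suc (k + k) * d)) → T (n * d)
  times d 1≤d (coprime k {u} {j} inv) D _ _ = T-× (modularHalved k u j inv) 1≤d D
  times d 1≤d (3×odd k) _ D rec = third (oddMod₃ k) refl
    where
    shuffle : ∀ m d → m * (3 * d) ≡ 3 * m * d
    shuffle = solve-∀
    third : ∀ {m} → OddMod₃ m → m ≡ suc (k + k) → T (3 * suc (k + k) * d)
    third (coprime l {u} {j} inv) eq = subst T (trans (shuffle (suc (l + l)) d) (cong (λ m → 3 * m * d) eq))
      (T-× (modularHalved l u j inv) (ℕ.≤-trans 1≤d (ℕ.m≤m+n d _)) D)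
    third (3×odd l) eq = subst T (trans (nine (suc (l + l)) d) (cong (λ m → 3 * m * d) eq))
      (T-× F₉ (ℕ.*-mono-≤ (s≤s (z≤n {l + l})) 1≤d) (rec l (trans (cong (3 *_) (sym eq)) (sym (nine′ (suc (l + l)))))))
      where
      nine : ∀ m d → 9 * (m * d) ≡ 3 * (3 * m) * d
      nine = solve-∀
      nine′ : ∀ m → 9 * m ≡ 3 * (3 * m)
      nine′ = solve-∀

  go : ∀ t → Acc _<_ t → 1 ≤ t → T t
  go t (acc rec) 1≤t with mod₄ t
  go _ (acc rec) ()  | 4× zero
  go _ (acc rec) 1≤t | 4× suc j = T-4× (s≤s z≤n) (go (suc j) (rec (k<m*k 2 j)) (s≤s z≤n))
  go _ (acc rec) 1≤t | odd k = subst T (ℕ.*-identityʳ (suc (k + k)))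
    (times 1 ℕ.≤-refl (oddMod₃ k) u₂ u₆ λ l eq → subst T (sym (ℕ.*-identityʳ (suc (l + l))))
      (go (suc (l + l)) (rec (subst (suc (l + l) <_) (sym eq) (k<m*k 7 (l + l)))) (s≤s z≤n)))
  go _ (acc rec) 1≤t | 2×odd k = subst T (ℕ.*-comm (suc (k + k)) 2)
    (times 2 (s≤s z≤n) (oddMod₃ k) u₄ t₆ λ l eq → subst T (ℕ.*-comm 2 (suc (l + l)))
      (go (2 * suc (l + l)) (rec (ℕ.*-monoʳ-< 2 (subst (suc (l + l) <_) (sym eq) (k<m*k 7 (l + l))))) (s≤s z≤n)))

theorem4p7 : ∀ (t : ℕ) → 4 ≤ t →
    Σ (BIBD (12 * t) 3 2) (λ 𝒟 →
    Σ (StrongNesting 𝒟 (18 * t)) (λ N → Optimal N))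
-- The pattern makes `12 * t` compute to a successor, as `LowerBound` requires.
theorem4p7 t@(suc _) 4≤t = toBIBD D , subst (StrongNesting (toBIBD D)) (points t) (toNesting D) , optimal
  where
  D : StrongDesign (12 * t) (6 * t)
  D = subst₂ StrongDesign (six t) (three t) (strongDesign t (s≤s z≤n))
    where
    six : ∀ t → 6 * (2 * t) ≡ 12 * t
    six = solve-∀
    three : ∀ t → 3 * (2 * t) ≡ 6 * t
    three = solve-∀

  points : ∀ t → 12 * t + 6 * t ≡ 18 * t
  points = solve-∀

  optimal : ∀ (𝒟′ : BIBD (12 * t) 3 2) w → StrongNesting 𝒟′ w → 18 * t ≤ w
  -- Parity closes the gap of one: 36 t is even and 2 w + 1 odd, so 36 t ≤ 2 w + 1 already forces 18
  -- t ≤ w.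
  optimal 𝒟′ w N = ℕ.≮⇒≥ λ w<18t → ℕ.<-irrefl refl (begin-strict
    2 * w + 1       <⟨ ℕ.n<1+n _ ⟩
    suc (2 * w + 1) ≡⟨ next w ⟩
    2 * suc w       ≤⟨ ℕ.*-monoʳ-≤ 2 w<18t ⟩
    2 * (18 * t)    ≡⟨ double t ⟩
    3 * (12 * t)    ≤⟨ LowerBound.3v≤2w+1 𝒟′ N ⟩
    2 * w + 1       ∎)
    where
    open ℕ.≤-Reasoning
    next : ∀ w → suc (2 * w + 1) ≡ 2 * suc w
    next = solve-∀
    double : ∀ t → 2 * (18 * t) ≡ 3 * (12 * t)
    double = solve-∀
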